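{- Let $M$ be a proper cellular pseudomanifold. Then $M$ is isomorphic to $\langle N,f\rangle$, where $N=M/\!\!\sim$ is primitive and $f:V(N)\to\mathbb Z^+$ is given by $f(A)=\#(A)$ for each $\sim$-equivalence class $A$ of $M$. Further, this representation of $M$ is unique up to isomorphism: if $M\cong\langle N',f'\rangle$ with $N'$ a primitive cellular pseudomanifold and $f':V(N')\to\mathbb Z^+$, then there is an isomorphism $\varphi:N'\to N$ with $f'=f\circ\varphi$.
   Context: A finite lattice $(X,<)$ is ranked if there is $\rho:X\to\mathbb N$ such that for each $x$ every maximal chain from $\mathbf 0$ to $x$ has length $\rho(x)$. For a ranked lattice $L$ with top $\mathbf 1$, $\Lambda(L)$ is the graph on the elements of rank $\rho(\mathbf 1)-1$, with $\sigma\ne\gamma$ adjacent iff $\rho(\sigma\wedge\gamma)=\rho(\mathbf 1)-2$. A cellular pseudomanifold is a finite ranked lattice $M$ such that for all $x<z$: if $\rho(z)=\rho(x)+2$ there are exactly two $y$ with $x<y<z$, and if $\rho(z)>\rho(x)+2$ then $\Lambda([x,z])$ is connected. Faces are its elements; vertices are the faces of rank $1$; $V(M)$ is the vertex set. The shadow of a face is the set of vertices below it; faces are identified with shadows. For vertices $x,y$, $x\sim y$ iff $x=y$ or the transposition of $x$ and $y$ induces an automorphism of $M$. $M$ is proper if every $\sim$-class is the shadow of a face, primitive if all $\sim$-classes are singletons. For proper $M$, $M/\!\!\sim$ is the poset (under inclusion) of sets $\{X_1,\dots,X_t\}$ of $\sim$-classes with $X_1\cup\dots\cup X_t$ the shadow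 of a face of $M$; its vertices are the $\sim$-classes. For a proper cellular pseudomanifold $N$ and $f:V(N)\to\mathbb Z^+$, choose pairwise disjoint sets $V_x$ ($x\in V(N)$) with $\#V_x=f(x)$; $\langle N,f\rangle$ is the poset, under inclusion, of all subsets $A\subseteq\bigcup_x V_x$ such that $\{x\in V(N):V_x\subseteq A\}$ is the shadow of a face of $N$. -}

module Defs where

open import Data.Nat using (ℕ; zero; suc; _+_; _∸_; _<_; _≤_)
open import Data.Fin using (Fin)
open import Data.Fin.Subset as Sub using (Subset; ⋃; ∣_∣)
open import Data.Bool using (Bool; T)
open import Data.List using (List)
open import Data.List.Relation.Unary.All using (All)
import Data.List.Relation.Binary.Subset.Propositional as LS
open import Data.Product using (Σ; ∃; ∃-syntax; _×_; _,_; proj₁; proj₂)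
open import Data.Sum using (_⊎_)
open import Relation.Binary.PropositionalEquality using (_≡_; _≢_)
open import Relation.Binary.Structures using (IsDecPartialOrder)
open import Relation.Binary.Construct.Closure.ReflexiveTransitive using (Star)
open import Function.Bundles using (_⇔_)

record FinPoset : Set₁ where
  field
    size   : ℕ
    _≤ₚ_   : Fin size → Fin size → Set
    isDPO  : IsDecPartialOrder _≡_ _≤ₚ_

open FinPoset public

module _ (P : FinPoset) where
  private
    El = Fin (size P)
    _≤'_ = _≤ₚ_ P

  _<ₚ_ : El → El → Set
  x <ₚ y = x ≤' y × x ≢ y

  _⋖_ : El → El → Set
  x ⋖ y = x <ₚ y × (∀ z → x <ₚ z → z <ₚ y → Data.Empty.⊥)
    where import Data.Empty

  IsBottom : El → Set
  IsBottom b = ∀ y → b ≤' y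

  IsTop : El → Set
  IsTop t = ∀ y → y ≤' t

  IsMeet : El → El → El → Set
  IsMeet x y m = m ≤' x × m ≤' y × (∀ w → w ≤' x → w ≤' y → w ≤' m)

  IsJoin : El → El → El → Set
  IsJoin x y j = x ≤' j × y ≤' j × (∀ w → x ≤' w → y ≤' w → j ≤' w)

  record IsFinLattice : Set where
    field
      inhabited : El
      meet      : ∀ x y → ∃[ m ] IsMeet x y m
      join      : ∀ x y → ∃[ j ] IsJoin x y j

  data MaxChain : El → El → ℕ → Set where
    done : ∀ {a} → MaxChain a a zero
    step : ∀ {a c b k} → a ⋖ c → MaxChain c b k → MaxChain a b (suc k)

  IsRankFunction : (El → ℕ) → Set
  IsRankFunction ρ = ∀ b → IsBottom b → ∀ x k → MaxChain b x k → k ≡ ρ x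

  -- Λ([x,z]) for the interval [x,z], expressed with the rank function of L
  -- (the rank function of [x,z] is y ↦ ρ y ∸ ρ x).
  module Lambda (ρ : El → ℕ) (x z : El) where
    InΛ : El → Set
    InΛ y = x ≤' y × y ≤' z × ρ y ≡ ρ z ∸ 1

    Adj : El → El → Set
    Adj σ γ = σ ≢ γ × ∃[ m ] (IsMeet σ γ m × ρ m ≡ ρ z ∸ 2)

    Edge : El → El → Set
    Edge σ γ = InΛ σ × InΛ γ × Adj σ γ

    Connected : Set
    Connected = ∀ σ γ → InΛ σ → InΛ γ → Star Edge σ γ

record IsCPM (P : FinPoset) : Set where
  field
    lattice : IsFinLattice P
    rank    : Fin (size P) → ℕ
    ranked  : IsRankFunction P rank
    diamond : ∀ x z → _<ₚ_ P x z → rank z ≡ rank x + 2 →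
              ∃[ y₁ ] ∃[ y₂ ] (y₁ ≢ y₂ × _<ₚ_ P x y₁ × _<ₚ_ P y₁ z
                              × _<ₚ_ P x y₂ × _<ₚ_ P y₂ z
                              × (∀ y → _<ₚ_ P x y → _<ₚ_ P y z → y ≡ y₁ ⊎ y ≡ y₂))
    connected : ∀ x z → _<ₚ_ P x z → rank x + 2 < rank z →
                Lambda.Connected P rank x z

open IsCPM public

record Iso (P Q : FinPoset) : Set where
  field
    to      : Fin (size P) → Fin (size Q)
    from    : Fin (size Q) → Fin (size P)
    from-to : ∀ x → from (to x) ≡ x
    to-from : ∀ y → to (from y) ≡ y
    mono    : ∀ x y → (_≤ₚ_ P x y ⇔ _≤ₚ_ Q (to x) (to y))

open Iso public

module _ (M : FinPoset) (c : IsCPM M) where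
  private
    El = Fin (size M)

  IsVertex : El → Set
  IsVertex v = rank c v ≡ 1

  Vertex : Set
  Vertex = Σ El IsVertex

  IsShadowOf : (El → Set) → El → Set
  IsShadowOf S z = ∀ w → (S w ⇔ (IsVertex w × _≤ₚ_ M w z))

  IsShadow : (El → Set) → Set
  IsShadow S = ∃[ z ] IsShadowOf S z

  _∼_ : El → El → Set
  x ∼ y = x ≡ y ⊎ Σ (Iso M M) (λ φ → to φ x ≡ y × to φ y ≡ x
                     × (∀ u → IsVertex u → u ≢ x → u ≢ y → to φ u ≡ u))

  ClassOf : El → El → Set
  ClassOf v w = IsVertex w × v ∼ w

  IsProper : Set
  IsProper = ∀ v → IsVertex v → IsShadow (ClassOf v)

  IsPrimitive : Set
  IsPrimitive = ∀ v w → IsVertex v → IsVertex w → v ∼ w → v ≡ w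

-- A finite poset P is isomorphic to the poset of those s : S with Q s,
-- ordered by the inclusion _⊑_ (s, s' identified when s ⊑ s' ⊑ s).

IsoToFamily : (P : FinPoset) (S : Set) (_⊑_ : S → S → Set) (Q : S → Set) → Set
IsoToFamily P S _⊑_ Q =
  Σ (Fin (size P) → S) λ φ →
    (∀ x → Q (φ x))
  × (∀ s → Q s → ∃[ x ] (φ x ⊑ s × s ⊑ φ x))
  × (∀ x y → (_≤ₚ_ P x y ⇔ (φ x ⊑ φ y)))

-- M/∼ : sets {X₁,…,X_t} (finite lists) of ∼-classes (as subsets of the
-- elements of M) with X₁ ∪ … ∪ X_t the shadow of a face, under inclusion.

module _ (M : FinPoset) (c : IsCPM M) where

  IsClass : Subset (size M) → Set
  IsClass C = ∃[ v ] (IsVertex M c v × ∀ w → (w Sub.∈ C ⇔ ClassOf M c v w))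

  QuotFace : List (Subset (size M)) → Set
  QuotFace L = All IsClass L × IsShadow M c (λ w → w Sub.∈ ⋃ L)

  QuotIso : FinPoset → Set
  QuotIso N = IsoToFamily N (List (Subset (size M))) LS._⊆_ QuotFace

  -- f(A) = #A : the vertex x of N corresponds to {A}, and f x = #A
  quotSize : {N : FinPoset} (cN : IsCPM N) → QuotIso N → Vertex N cN → ℕ
  quotSize cN ψ (x , _) = ∣ ⋃ (proj₁ ψ x) ∣

-- ⟨N,f⟩ with the canonical choice V_x = {x} × Fin (f x); subsets of
-- ⋃ V_x are Boolean predicates, ordered by inclusion.

module _ (N : FinPoset) (c : IsCPM N) (f : Vertex N c → ℕ) where

  Ground : Set
  Ground = Σ (Vertex N c) (λ x → Fin (f x))

  _⊆ᴳ_ : (Ground → Bool) → (Ground → Bool) → Set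
  A ⊆ᴳ B = ∀ u → T (A u) → T (B u)

  AngleFace : (Ground → Bool) → Set
  AngleFace A = ∃[ z ] (∀ (x : Vertex N c) →
                  ((∀ k → T (A (x , k))) ⇔ _≤ₚ_ N (proj₁ x) z))

  IsoAngle : FinPoset → Set
  IsoAngle M = IsoToFamily M (Ground → Bool) _⊆ᴳ_ AngleFace

{-# OPTIONS --safe #-}
module Submission where

-- Let x ≠ y be vertices whose transposition τ is an automorphism. If a face F contains x but not
-- y, then F ∖ {x} = F ∩ τF is a face. If F contains neither, then F ∪ {x} is a face: strong
-- connectivity and the diamond property show that a facet of a face through x and y meets
-- {x,y}. So whether a vertex set is a face of M depends only on the ∼-classes it contains, which
-- gives M ≅ ⟨N,f⟩. Moreover the set s of all vertices but one from each class is a face, and M/∼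
-- is isomorphic to the interval [s,𝟏], hence a cellular pseudomanifold. The same two operations,
-- applied in N, show that a transposition automorphism of N would merge two classes of M;
-- applied in M ≅ ⟨N′,f′⟩, they show that the classes of M are exactly the sets V_x.

open import Defs
open import Data.Bool using (Bool; true; T)
open import Data.Bool.Properties using (T?)
open import Data.Empty using (⊥; ⊥-elim)
open import Data.Fin using (Fin; zero; suc; fromℕ<)
open import Data.Fin.Properties using (_≟_; any?; all?; suc-injective; cantor-schröder-bernstein)
open import Data.Fin.Subset as Sub using (Subset; ∣_∣; inside; outside; ⋃)
import Data.Fin.Subset.Properties as Subₚ
open import Data.List using (List; []; _∷_; allFin; map; filter)
open import Data.List.Membership.Propositional using (_∈_)
open import Data.List.Membership.Propositional.Properties using (∈-allFin; ∈-map∘filter⁺; ∈-map∘filter⁻)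
import Data.List.Relation.Unary.All as All
open import Data.List.Relation.Unary.Any using (here; there)
open import Data.Nat as ℕ using (ℕ; zero; suc; _+_; _∸_; s≤s; z≤n)
import Data.Nat.Properties as ℕₚ
open import Data.Product using (Σ; ∃; ∃-syntax; _×_; _,_; proj₁; proj₂)
open import Data.Sum using (_⊎_; inj₁; inj₂; [_,_]′)
open import Data.Vec using (_∷_; tabulate; here; there)
open import Data.Vec.Properties using (lookup∘tabulate; []=⇒lookup; lookup⇒[]=)
open import Function using (_∘_; id)
open import Function.Bundles using (_⇔_; mk⇔; Equivalence)
open import Relation.Binary.Construct.Closure.ReflexiveTransitive using (Star; ε; _◅_)
open import Relation.Binary.PropositionalEquality using (_≡_; _≢_; refl; sym; trans; cong; subst; isEquivalence)
open import Relation.Binary.Structures using (IsDecPartialOrder)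
open import Relation.Nullary using (¬_; Dec; yes; no; does)
open import Relation.Nullary.Decidable using (dec-true; _×-dec_; _⊎-dec_; _→-dec_; ¬?; decidable-stable)
open import Relation.Unary using (Decidable)

open Equivalence using () renaming (to to fwd; from to bwd)

-- Removal is a meet, but union is no lattice operation: a priori `F ∨ x` may contain more than `F`
-- and `x`, and excluding this is the hard step. Properness enters twice. `x ∼ y` asks for an
-- automorphism and is not visibly decidable; since the class of `x` is the shadow of a face,
-- membership in it becomes a comparison in the order, representatives can be chosen, and vertex
-- sets can be rebuilt one vertex at a time. Properness also makes each class a face, hence a vertex
-- of M/∼. The set `s` is a face because, like the empty set, it contains no whole class. A face
-- above `s` is `s` together with some representatives, so it records exactly which classes it
-- contains. Realising M/∼ as an interval lets it inherit rank, diamonds and connectivity from `M`.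

⇔-refl : {A : Set} → A ⇔ A
⇔-refl = mk⇔ id id

⇔-sym : {A B : Set} → A ⇔ B → B ⇔ A
⇔-sym e = mk⇔ (bwd e) (fwd e)

infixr 5 _⇔∘_
_⇔∘_ : {A B C : Set} → A ⇔ B → B ⇔ C → A ⇔ C
e ⇔∘ f = mk⇔ (fwd f ∘ fwd e) (bwd e ∘ bwd f)

T-does : {A : Set} (a? : Dec A) → T (does a?) ⇔ A
T-does (yes a) = mk⇔ (λ _ → a) _
T-does (no ¬a) = mk⇔ (λ ()) ¬a

-- Decidable subsets of `Fin n` and their enumerations.

module _ {n : ℕ} {Q : Fin n → Set} (Q? : Decidable Q) where

  comprehension : Subset n
  comprehension = tabulate (does ∘ Q?)

  ∈-comprehension : ∀ {i} → i Sub.∈ comprehension ⇔ Q i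
  ∈-comprehension {i} = mk⇔
    (λ i∈ → witness (Q? i) (trans (sym (lookup∘tabulate (does ∘ Q?) i)) ([]=⇒lookup i∈)))
    (λ q → lookup⇒[]= i _ (trans (lookup∘tabulate (does ∘ Q?) i) (dec-true (Q? i) q)))
    where
    witness : {A : Set} (a? : Dec A) → does a? ≡ true → A
    witness (yes a) _ = a

enum : ∀ {n} (C : Subset n) → Fin ∣ C ∣ → Fin n
enum (inside  ∷ C) zero    = zero
enum (inside  ∷ C) (suc k) = suc (enum C k)
enum (outside ∷ C) k       = suc (enum C k)

enum-∈ : ∀ {n} (C : Subset n) k → enum C k Sub.∈ C
enum-∈ (inside  ∷ C) zero    = here
enum-∈ (inside  ∷ C) (suc k) = there (enum-∈ C k)
enum-∈ (outside ∷ C) k       = there (enum-∈ C k)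

index : ∀ {n} (C : Subset n) {i} → i Sub.∈ C → Fin ∣ C ∣
index (inside  ∷ C) here       = zero
index (inside  ∷ C) (there i∈) = suc (index C i∈)
index (outside ∷ C) (there i∈) = index C i∈

enum-index : ∀ {n} (C : Subset n) {i} (i∈ : i Sub.∈ C) → enum C (index C i∈) ≡ i
enum-index (inside  ∷ C) here       = refl
enum-index (inside  ∷ C) (there i∈) = cong suc (enum-index C i∈)
enum-index (outside ∷ C) (there i∈) = cong suc (enum-index C i∈)

enum-injective : ∀ {n} (C : Subset n) {k l} → enum C k ≡ enum C l → k ≡ l
enum-injective (inside  ∷ C) {zero}  {zero}  _  = refl
enum-injective (inside  ∷ C) {suc k} {suc l} eq =
  cong suc (enum-injective C (suc-injective eq))
enum-injective (outside ∷ C) eq = enum-injective C (suc-injective eq)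

-- Order, rank and shadows in a cellular pseudomanifold.

module Theory (P : FinPoset) (c : IsCPM P) where

  El : Set
  El = Fin (size P)

  infix 4 _≤_ _<_ _≤?_ _⋖′_
  _≤_ _<_ _⋖′_ : El → El → Set
  _≤_  = _≤ₚ_ P
  _<_  = _<ₚ_ P
  _⋖′_ = _⋖_ P

  ρ : El → ℕ
  ρ = rank c

  V : El → Set
  V = IsVertex P c

  V? : Decidable V
  V? v = ρ v ℕ.≟ 1

  private module O = IsDecPartialOrder (isDPO P)

  _≤?_ : ∀ x y → Dec (x ≤ y)
  _≤?_ = O._≤?_

  ≤-refl : ∀ {x} → x ≤ x
  ≤-refl = O.refl

  ≤-reflexive : ∀ {x y} → x ≡ y → x ≤ y
  ≤-reflexive = O.reflexive

  ≤-trans : ∀ {x y z} → x ≤ y → y ≤ z → x ≤ z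
  ≤-trans = O.trans

  ≤-antisym : ∀ {x y} → x ≤ y → y ≤ x → x ≡ y
  ≤-antisym = O.antisym

  _<?_ : ∀ x y → Dec (x < y)
  x <? y = (x ≤? y) ×-dec ¬? (x ≟ y)

  ≤∧≱⇒< : ∀ {x y} → x ≤ y → ¬ y ≤ x → x < y
  ≤∧≱⇒< x≤y y≰x = x≤y , λ { refl → y≰x x≤y }

  <-≤-trans : ∀ {x y z} → x < y → y ≤ z → x < z
  <-≤-trans (x≤y , x≢y) y≤z = ≤-trans x≤y y≤z , λ { refl → x≢y (≤-antisym x≤y y≤z) }

  ≤-<-trans : ∀ {x y z} → x ≤ y → y < z → x < z
  ≤-<-trans x≤y (y≤z , y≢z) = ≤-trans x≤y y≤z , λ { refl → y≢z (≤-antisym y≤z x≤y) }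

  open IsFinLattice (lattice c)

  infixr 7 _∧_ _∨_
  _∧_ _∨_ : El → El → El
  x ∧ y = proj₁ (meet x y)
  x ∨ y = proj₁ (join x y)

  ∧-≤ˡ : ∀ x y → x ∧ y ≤ x
  ∧-≤ˡ x y = proj₁ (proj₂ (meet x y))

  ∧-≤ʳ : ∀ x y → x ∧ y ≤ y
  ∧-≤ʳ x y = proj₁ (proj₂ (proj₂ (meet x y)))

  ∧-greatest : ∀ {x y w} → w ≤ x → w ≤ y → w ≤ x ∧ y
  ∧-greatest {x} {y} = proj₂ (proj₂ (proj₂ (meet x y))) _

  ∨-≥ˡ : ∀ x y → x ≤ x ∨ y
  ∨-≥ˡ x y = proj₁ (proj₂ (join x y))

  ∨-≥ʳ : ∀ x y → y ≤ x ∨ y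
  ∨-≥ʳ x y = proj₁ (proj₂ (proj₂ (join x y)))

  ∨-least : ∀ {x y w} → x ≤ w → y ≤ w → x ∨ y ≤ w
  ∨-least {x} {y} = proj₂ (proj₂ (proj₂ (join x y))) _

  private
    -- The lattice axioms supply an inhabitant and binary meets; the bottom is obtained as the meet
    -- of all elements.
    lowerBound : (l : List El) → ∃[ b ] (∀ {y} → y ∈ l → b ≤ y)
    lowerBound []      = inhabited , λ ()
    lowerBound (x ∷ l) with b , b≤ ← lowerBound l = x ∧ b ,
      λ { (here refl) → ∧-≤ˡ x b ; (there y∈) → ≤-trans (∧-≤ʳ x b) (b≤ y∈) }

  𝟎 : El
  𝟎 = proj₁ (lowerBound (allFin _))

  𝟎-min : IsBottom P 𝟎
  𝟎-min y = proj₂ (lowerBound (allFin _)) (∈-allFin y)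

  private
    -- Measure for the construction of maximal chains. Rank cannot serve yet: its monotonicity is
    -- itself derived from the existence of chains.
    height : El → ℕ
    height a = ∣ comprehension (_≤? a) ∣

    height-< : ∀ {a b} → a < b → height a ℕ.< height b
    height-< {a} {b} (a≤b , a≢b) = Subₚ.p⊂q⇒∣p∣<∣q∣
      ( (λ i∈ → bwd (∈-comprehension (_≤? b)) (≤-trans (fwd (∈-comprehension (_≤? a)) i∈) a≤b))
      , b , bwd (∈-comprehension (_≤? b)) ≤-refl
      , λ b∈ → a≢b (≤-antisym a≤b (fwd (∈-comprehension (_≤? a)) b∈)))

  chain-++ : ∀ {a b d k l} → MaxChain P a b k → MaxChain P b d l → MaxChain P a d (k + l)
  chain-++ done       q = q
  chain-++ (step e p) q = step e (chain-++ p q)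

  private
    chain-fuel : ∀ n a b → height b ℕ.≤ height a + n → a ≤ b → ∃[ k ] MaxChain P a b k
    chain-fuel n a b h a≤b with a ≟ b
    ... | yes refl = 0 , done
    ... | no a≢b with any? (λ z → (a <? z) ×-dec (z <? b))
    ...   | no none = 1 , step ((a≤b , a≢b) , λ z p q → none (z , p , q)) done
    chain-fuel zero a b h a≤b | no a≢b | yes _ =
      ⊥-elim (ℕₚ.<⇒≱ (height-< (a≤b , a≢b)) (subst (height b ℕ.≤_) (ℕₚ.+-identityʳ _) h))
    chain-fuel (suc n) a b h a≤b | no a≢b | yes (z , a<z , z<b) =
      let h′ : height b ℕ.≤ suc (height a + n)
          h′ = subst (height b ℕ.≤_) (ℕₚ.+-suc _ n) h
          k , p = chain-fuel n a z
                    (ℕₚ.≤-pred (ℕₚ.≤-trans (height-< z<b) h′)) (proj₁ a<z)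
          l , q = chain-fuel n z b
                    (ℕₚ.≤-trans h′ (ℕₚ.+-monoˡ-≤ n (height-< a<z))) (proj₁ z<b)
      in k + l , chain-++ p q

  chain : ∀ {a b} → a ≤ b → ∃[ k ] MaxChain P a b k
  chain {a} {b} = chain-fuel (height b) a b (ℕₚ.m≤n+m _ _)

  -- `ranked` speaks only of chains that start at a bottom, so a chain from `𝟎` to `a` is put in
  -- front of the given one.
  rank-chain : ∀ {a b k} → MaxChain P a b k → ρ b ≡ ρ a + k
  rank-chain {a} {b} {k} q with j , p ← chain (𝟎-min a) =
    trans (sym (ranked c 𝟎 𝟎-min b _ (chain-++ p q)))
          (cong (_+ k) (ranked c 𝟎 𝟎-min a j p))

  rank-𝟎 : ρ 𝟎 ≡ 0
  rank-𝟎 = sym (ranked c 𝟎 𝟎-min 𝟎 0 done)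

  rank-⋖ : ∀ {a b} → a ⋖′ b → ρ b ≡ suc (ρ a)
  rank-⋖ {a} a⋖b = trans (rank-chain (step a⋖b done)) (ℕₚ.+-comm (ρ a) 1)

  lowerCover : ∀ {a b} → a < b → ∃[ d ] (a ≤ d × d ⋖′ b)
  lowerCover {a} {b} (a≤b , a≢b) = last (proj₂ (chain a≤b)) a≢b
    where
    last : ∀ {a b k} → MaxChain P a b k → a ≢ b → ∃[ d ] (a ≤ d × d ⋖′ b)
    last done a≢a = ⊥-elim (a≢a refl)
    last {b = b} (step {c = e} a⋖e p) _ with e ≟ b
    ... | yes refl = _ , ≤-refl , a⋖e
    ... | no e≢b with d , e≤d , d⋖b ← last p e≢b = d , ≤-trans (proj₁ (proj₁ a⋖e)) e≤d , d⋖b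

  rank-mono-≤ : ∀ {a b} → a ≤ b → ρ a ℕ.≤ ρ b
  rank-mono-≤ {a} a≤b with k , p ← chain a≤b =
    subst (ρ a ℕ.≤_) (sym (rank-chain p)) (ℕₚ.m≤m+n _ k)

  rank-mono-< : ∀ {a b} → a < b → ρ a ℕ.< ρ b
  rank-mono-< {a} a<b with d , a≤d , d⋖b ← lowerCover a<b =
    subst (ρ a ℕ.<_) (sym (rank-⋖ d⋖b)) (s≤s (rank-mono-≤ a≤d))

  ≤∧rank≥⇒≡ : ∀ {a b} → a ≤ b → ρ b ℕ.≤ ρ a → a ≡ b
  ≤∧rank≥⇒≡ {a} {b} a≤b r with a ≟ b
  ... | yes a≡b = a≡b
  ... | no a≢b  = ⊥-elim (ℕₚ.<⇒≱ (rank-mono-< (a≤b , a≢b)) r)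

  rank-suc⇒⋖ : ∀ {a b} → a ≤ b → ρ b ≡ suc (ρ a) → a ⋖′ b
  rank-suc⇒⋖ {a} a≤b eq =
    (a≤b , λ { refl → ℕₚ.1+n≢n (sym eq) }) ,
    λ z a<z z<b → ℕₚ.<⇒≱ (rank-mono-< z<b)
      (subst (ℕ._≤ ρ z) (sym eq) (rank-mono-< a<z))

  V-minimal : ∀ {v w} → V v → V w → v ≤ w → v ≡ w
  V-minimal v w v≤w = ≤∧rank≥⇒≡ v≤w (ℕₚ.≤-reflexive (trans w (sym v)))

  V⇒𝟎⋖ : ∀ {v} → V v → 𝟎 ⋖′ v
  V⇒𝟎⋖ v = rank-suc⇒⋖ (𝟎-min _) (trans v (cong suc (sym rank-𝟎)))

  𝟎⋖⇒V : ∀ {v} → 𝟎 ⋖′ v → V v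
  𝟎⋖⇒V p = trans (rank-⋖ p) (cong suc rank-𝟎)

  V≰𝟎 : ∀ {v} → V v → ¬ v ≤ 𝟎
  V≰𝟎 {v} vv v≤𝟎 with () ← subst (ℕ._≤ 0) vv (subst (ρ v ℕ.≤_) rank-𝟎 (rank-mono-≤ v≤𝟎))

  rank0⇒≤ : ∀ {a} b → ρ a ≡ 0 → a ≤ b
  rank0⇒≤ b eq = subst (_≤ b)
    (≤∧rank≥⇒≡ (𝟎-min _) (ℕₚ.≤-reflexive (trans eq (sym rank-𝟎)))) (𝟎-min b)

  no-three-between : ∀ {x z} → ρ z ≡ ρ x + 2 → ∀ {a b d} →
    x < a → a < z → x < b → b < z → x < d → d < z → a ≢ b → a ≢ d → b ≢ d → ⊥
  no-three-between {x} {z} eq x<a a<z x<b b<z x<d d<z a≢b a≢d b≢d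
    with y₁ , y₂ , _ , _ , _ , _ , _ , only ←
           diamond c x z (<-≤-trans x<a (proj₁ a<z)) eq
    with only _ x<a a<z | only _ x<b b<z | only _ x<d d<z
  ... | inj₁ refl | inj₁ refl | _         = a≢b refl
  ... | inj₁ refl | _         | inj₁ refl = a≢d refl
  ... | inj₂ refl | inj₂ refl | _         = a≢b refl
  ... | inj₂ refl | _         | inj₂ refl = a≢d refl
  ... | _         | inj₁ refl | inj₁ refl = b≢d refl
  ... | _         | inj₂ refl | inj₂ refl = b≢d refl

  -- A face of rank ≥ 2 is the join of two of its facets, so faces are determined by shadows.
  atomistic : ∀ {a b} → (∀ w → V w → w ≤ a → w ≤ b) → a ≤ b
  atomistic {a} {b} = go (ρ a) a ℕₚ.≤-refl
    where
    go : ∀ n a → ρ a ℕ.≤ n → (∀ w → V w → w ≤ a → w ≤ b) → a ≤ b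
    go n a r h with ρ a in eq
    ... | 0 = rank0⇒≤ b eq
    ... | 1 = h a eq ≤-refl
    go (suc n) a (s≤s r) h | suc (suc m)
      with lowerCover (𝟎-min a , λ { refl → ℕₚ.0≢1+n (trans (sym rank-𝟎) eq) })
    ... | d , _ , d⋖a
      with lowerCover (𝟎-min d , λ { refl →
             ℕₚ.0≢1+n (trans (sym rank-𝟎) (ℕₚ.suc-injective (trans (sym (rank-⋖ d⋖a)) eq))) })
    ... | e , _ , e⋖d
      with diamond c e a (<-≤-trans (proj₁ e⋖d) (proj₁ (proj₁ d⋖a)))
             (trans (rank-⋖ d⋖a) (trans (cong suc (rank-⋖ e⋖d)) (ℕₚ.+-comm 2 (ρ e))))
    ... | y₁ , y₂ , y₁≢y₂ , e<y₁ , y₁<a , e<y₂ , y₂<a , _ =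
      subst (_≤ b) j≡a (∨-least (below y₁ y₁<a) (below y₂ y₂<a))
      where
      ρa : ρ a ≡ suc (suc (ρ e))
      ρa = trans (rank-⋖ d⋖a) (cong suc (rank-⋖ e⋖d))
      below : ∀ y → y < a → y ≤ b
      below y y<a = go n y
        (ℕₚ.≤-trans (ℕₚ.≤-pred (subst (ρ y ℕ.<_) eq (rank-mono-< y<a))) r)
        (λ w vw w≤y → h w vw (≤-trans w≤y (proj₁ y<a)))
      same-rank : ∀ y → e < y → y < a → ρ y ≡ suc (ρ e)
      same-rank y e<y y<a = ℕₚ.≤-antisym
        (ℕₚ.≤-pred (subst (ρ y ℕ.<_) ρa (rank-mono-< y<a))) (rank-mono-< e<y)
      y₁<j : y₁ < y₁ ∨ y₂
      y₁<j = ∨-≥ˡ y₁ y₂ , λ y₁≡j → y₁≢y₂ (sym (≤∧rank≥⇒≡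
        (subst (y₂ ≤_) (sym y₁≡j) (∨-≥ʳ y₁ y₂))
        (ℕₚ.≤-reflexive (trans (same-rank y₁ e<y₁ y₁<a) (sym (same-rank y₂ e<y₂ y₂<a))))))
      j≡a : y₁ ∨ y₂ ≡ a
      j≡a = ≤∧rank≥⇒≡ (∨-least (proj₁ y₁<a) (proj₁ y₂<a))
        (subst (ℕ._≤ ρ (y₁ ∨ y₂)) (sym ρa)
          (subst (ℕ._< ρ (y₁ ∨ y₂)) (same-rank y₁ e<y₁ y₁<a) (rank-mono-< y₁<j)))

  shadow-≡ : ∀ {a b} → (∀ w → V w → w ≤ a ⇔ w ≤ b) → a ≡ b
  shadow-≡ h = ≤-antisym (atomistic (λ w v → fwd (h w v))) (atomistic (λ w v → bwd (h w v)))

  vertexBetween : ∀ {a b} → ¬ b ≤ a → ∃[ w ] (V w × w ≤ b × ¬ w ≤ a)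
  vertexBetween {a} {b} b≰a with any? (λ w → V? w ×-dec ((w ≤? b) ×-dec ¬? (w ≤? a)))
  ... | yes p = p
  ... | no none = ⊥-elim (b≰a (atomistic λ w v w≤b →
          decidable-stable (w ≤? a) λ w≰a → none (w , v , w≤b , w≰a)))

  Face : (El → Set) → Set
  Face A = ∃[ z ] (∀ w → V w → A w ⇔ w ≤ z)

  Face-resp : ∀ {A B} → (∀ w → V w → A w ⇔ B w) → Face A → Face B
  Face-resp h (z , e) = z , λ w v → ⇔-sym (h w v) ⇔∘ e w v

  -- Transposition automorphisms: removing and adding a vertex.

  record Swap (x y : El) : Set where
    field
      φ      : Iso P P
      x↦y    : to φ x ≡ y
      y↦x    : to φ y ≡ x
      others : ∀ u → V u → u ≢ x → u ≢ y → to φ u ≡ u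

  module _ {x y : El} (vx : V x) (vy : V y) (σ : Swap x y) where
    open Swap σ

    private
      τ : El → El
      τ = to φ

      τ-≤ : ∀ {a b} → a ≤ b → τ a ≤ τ b
      τ-≤ = fwd (mono φ _ _)

      τ-≤⁻ : ∀ {a b} → τ a ≤ τ b → a ≤ b
      τ-≤⁻ = bwd (mono φ _ _)

      τ-< : ∀ {a b} → a < b → τ a < τ b
      τ-< (a≤b , a≢b) = τ-≤ a≤b , λ eq →
        a≢b (trans (sym (from-to φ _)) (trans (cong (from φ) eq) (from-to φ _)))

    x≤τ : ∀ {F} → x ≤ τ F ⇔ y ≤ F
    x≤τ {F} = mk⇔ (λ p → τ-≤⁻ (subst (_≤ τ F) (sym y↦x) p)) (λ p → subst (_≤ τ F) y↦x (τ-≤ p))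

    y≤τ : ∀ {F} → y ≤ τ F ⇔ x ≤ F
    y≤τ {F} = mk⇔ (λ p → τ-≤⁻ (subst (_≤ τ F) (sym x↦y) p)) (λ p → subst (_≤ τ F) x↦y (τ-≤ p))

    others≤τ : ∀ {F w} → V w → w ≢ x → w ≢ y → w ≤ τ F ⇔ w ≤ F
    others≤τ {F} {w} v w≢x w≢y = mk⇔
      (λ p → τ-≤⁻ (subst (_≤ τ F) (sym (others w v w≢x w≢y)) p))
      (λ p → subst (_≤ τ F) (others w v w≢x w≢y) (τ-≤ p))

    τ-fixes : ∀ {F} → x ≤ F ⇔ y ≤ F → τ F ≡ F
    τ-fixes {F} e = shadow-≡ go
      where
      go : ∀ w → V w → w ≤ τ F ⇔ w ≤ F
      go w v with w ≟ x | w ≟ y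
      ... | yes refl | _        = x≤τ ⇔∘ ⇔-sym e
      ... | no _     | yes refl = y≤τ ⇔∘ e
      ... | no w≢x   | no w≢y   = others≤τ v w≢x w≢y

    τ-fixes-both : ∀ {F} → x ≤ F → y ≤ F → τ F ≡ F
    τ-fixes-both p q = τ-fixes (mk⇔ (λ _ → q) (λ _ → p))

    τ-fixes-neither : ∀ {F} → ¬ x ≤ F → ¬ y ≤ F → τ F ≡ F
    τ-fixes-neither p q = τ-fixes (mk⇔ (⊥-elim ∘ p) (⊥-elim ∘ q))

    -- F ∖ {x} = F ∩ τ F.
    remove : ∀ {F} → x ≤ F → ¬ y ≤ F → Face (λ w → w ≤ F × w ≢ x)
    remove {F} x≤F y≰F = F ∧ τ F , λ w v → mk⇔
      (λ (w≤F , w≢x) → ∧-greatest w≤F (bwd (others≤τ v w≢x λ { refl → y≰F w≤F }) w≤F))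
      (λ p → ≤-trans p (∧-≤ˡ F (τ F)) ,
             λ { refl → y≰F (fwd x≤τ (≤-trans p (∧-≤ʳ F (τ F)))) })

    module _ (x≢y : x ≢ y) where

      -- Walk in Λ([𝟎,G]) from F to a facet through x. The first facet γ met on the way that
      -- meets {x,y} contains both (otherwise γ and τ γ are two further facets over the same
      -- ridge), and the ridge then gives a smaller instance inside γ.
      facet-meets : ∀ n {F G} → ρ G ℕ.≤ n → F ⋖′ G → x ≤ G → y ≤ G → ¬ x ≤ F → ¬ y ≤ F → ⊥
      facet-meets n {F} {G} r F⋖G x≤G y≤G x≰F y≰F with ρ G in eq
      ... | 0 = ℕₚ.0≢1+n (trans (sym eq) (rank-⋖ F⋖G))
      ... | 1 = x≢y (trans (V-minimal vx eq x≤G) (sym (V-minimal vy eq y≤G)))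
      -- Connectivity says nothing at this rank, but `F`, `x` and `y` would be three distinct atoms
      -- inside one diamond.
      ... | 2 = no-three-between {𝟎} (trans eq (sym (cong (_+ 2) rank-𝟎)))
                  (atom<.left vF) (proj₁ F⋖G) (atom<.left vx) (atom<.right vx x≤G)
                  (atom<.left vy) (atom<.right vy y≤G)
                  (λ { refl → x≰F ≤-refl }) (λ { refl → y≰F ≤-refl }) x≢y
        where
        vF : V F
        vF = ℕₚ.suc-injective (trans (sym (rank-⋖ F⋖G)) eq)
        module atom< {v} (vv : V v) where
          left : 𝟎 < v
          left = proj₁ (V⇒𝟎⋖ vv)
          right : v ≤ G → v < G
          right v≤G = v≤G , λ { refl → ℕₚ.1+n≢n (trans (sym eq) vv) }
      facet-meets (suc n) {F} {G} (s≤s r) F⋖G x≤G y≤G x≰F y≰F | suc (suc (suc m))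
        with H , x≤H , H⋖G ← lowerCover {x} {G}
               (x≤G , λ { refl → ℕₚ.1+n≢0 (ℕₚ.suc-injective (trans (sym eq) vx)) }) =
        walk x≰F y≰F (connected c 𝟎 G (≤-<-trans (𝟎-min F) (proj₁ F⋖G)) long F H (inΛ F⋖G) (inΛ H⋖G)) x≤H
        where
        open Lambda P ρ 𝟎 G
        long : ρ 𝟎 + 2 ℕ.< ρ G
        long rewrite rank-𝟎 | eq = s≤s (s≤s (s≤s z≤n))
        inΛ : ∀ {H} → H ⋖′ G → InΛ H
        inΛ H⋖G = 𝟎-min _ , proj₁ (proj₁ H⋖G) , cong (_∸ 1) (sym (rank-⋖ H⋖G))
        facet< : ∀ {H} → InΛ H → H < G
        facet< (_ , H≤G , ρH) = H≤G , λ { refl → ℕₚ.1+n≢n (trans (sym eq) (trans ρH (cong (_∸ 1) eq))) }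
        walk : ∀ {σ H} → ¬ x ≤ σ → ¬ y ≤ σ → Star Edge σ H → ¬ x ≤ H
        walk x≰σ y≰σ ε = x≰σ
        walk {σ} x≰σ y≰σ (_◅_ {j = γ} (σΛ , γΛ@(_ , γ≤G , ργ) , σ≢γ , d , (d≤σ , d≤γ , _) , ρd) path) =
          cases (x ≤? γ) (y ≤? γ)
          where
          ρd′ : ρ d ≡ suc m
          ρd′ = trans ρd (cong (_∸ 2) eq)
          ργ′ : ρ γ ≡ suc (suc m)
          ργ′ = trans ργ (cong (_∸ 1) eq)
          ρσ′ : ρ σ ≡ suc (suc m)
          ρσ′ = trans (proj₂ (proj₂ σΛ)) (cong (_∸ 1) eq)
          d<facet : ∀ {H} → d ≤ H → ρ H ≡ suc (suc m) → d < H
          d<facet d≤H ρH = d≤H , λ { refl → ℕₚ.1+n≢n (trans (sym ρH) ρd′) }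
          x≰d : ¬ x ≤ d
          x≰d x≤d = x≰σ (≤-trans x≤d d≤σ)
          y≰d : ¬ y ≤ d
          y≰d y≤d = y≰σ (≤-trans y≤d d≤σ)
          -- `d` avoids `x` and `y` while `G` contains both, so `τ` fixes `d` and `G` and preserves
          -- the interval between them.
          d<τγ : d < τ γ
          d<τγ = subst (_< τ γ) (τ-fixes-neither x≰d y≰d) (τ-< (d<facet d≤γ ργ′))
          τγ<G : τ γ < G
          τγ<G = subst (τ γ <_) (τ-fixes-both x≤G y≤G) (τ-< (facet< γΛ))
          three : σ ≢ τ γ → γ ≢ τ γ → ⊥
          three = no-three-between {d}
            (trans eq (trans (ℕₚ.+-comm 2 (suc m)) (cong (_+ 2) (sym ρd′))))
            (d<facet d≤σ ρσ′) (facet< σΛ) (d<facet d≤γ ργ′) (facet< γΛ) d<τγ τγ<G σ≢γ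
          cases : Dec (x ≤ γ) → Dec (y ≤ γ) → ¬ x ≤ _
          cases (no x≰γ)  (no y≰γ)  = walk x≰γ y≰γ path
          cases (yes x≤γ) (yes y≤γ) = ⊥-elim (facet-meets n (ℕₚ.≤-trans (ℕₚ.≤-reflexive ργ′) r)
            (rank-suc⇒⋖ d≤γ (trans ργ′ (cong suc (sym ρd′)))) x≤γ y≤γ x≰d y≰d)
          cases (yes x≤γ) (no y≰γ)  = ⊥-elim (three
            (λ σ≡ → y≰σ (subst (y ≤_) (sym σ≡) (bwd y≤τ x≤γ)))
            (λ γ≡ → y≰γ (subst (y ≤_) (sym γ≡) (bwd y≤τ x≤γ))))
          cases (no x≰γ)  (yes y≤γ) = ⊥-elim (three
            (λ σ≡ → x≰σ (subst (x ≤_) (sym σ≡) (bwd x≤τ y≤γ)))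
            (λ γ≡ → x≰γ (subst (x ≤_) (sym γ≡) (bwd x≤τ y≤γ))))

      -- The face is `F ∨ x`: `facet-meets` excludes `y` from it, and deleting `x` from it then
      -- leads back to `F`.
      add : ∀ {F} → ¬ x ≤ F → ¬ y ≤ F → Face (λ w → w ≤ F ⊎ w ≡ x)
      add {F} x≰F y≰F with y ≤? (F ∨ x)
      -- A facet `H` of `F ∨ x` above `F` cannot contain `x`. Nor can it contain `y`: `τ H` would
      -- then contain `F` and `x`, hence `F ∨ x`, which `τ` fixes.
      ... | yes y≤G = ⊥-elim (contra (lowerCover (≤∧≱⇒< (∨-≥ˡ F x) λ G≤F → x≰F (≤-trans (∨-≥ʳ F x) G≤F))))
        where
        G = F ∨ x
        contra : ∃[ H ] (F ≤ H × H ⋖′ G) → ⊥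
        contra (H , F≤H , H⋖G) = facet-meets (ρ G) ℕₚ.≤-refl H⋖G (∨-≥ʳ F x) y≤G x≰H y≰H
          where
          G≰H : ¬ G ≤ H
          G≰H G≤H = proj₂ (proj₁ H⋖G) (≤-antisym (proj₁ (proj₁ H⋖G)) G≤H)
          x≰H : ¬ x ≤ H
          x≰H x≤H = G≰H (∨-least F≤H x≤H)
          y≰H : ¬ y ≤ H
          y≰H y≤H = G≰H (τ-≤⁻ (subst (_≤ τ H) (sym (τ-fixes-both (∨-≥ʳ F x) y≤G))
            (∨-least (subst (_≤ τ H) (τ-fixes-neither x≰F y≰F) (τ-≤ F≤H)) (bwd x≤τ y≤H))))
      -- `G′` is `G` without `x`. A face above `F` and strictly below `G` omits `x`, so it lies in
      -- `G′`; in particular `G′` is a facet of `G`.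
      ... | no y≰G with G′ , G′-shadow ← remove (∨-≥ʳ F x) y≰G = G , λ w v → mk⇔
          [ (λ w≤F → ≤-trans w≤F (∨-≥ˡ F x)) , (λ { refl → ∨-≥ʳ F x }) ]′ (split w v)
        where
        G = F ∨ x
        x≰G′ : ¬ x ≤ G′
        x≰G′ x≤G′ = proj₂ (bwd (G′-shadow x vx) x≤G′) refl
        G′≤G : G′ ≤ G
        G′≤G = atomistic λ w v w≤G′ → proj₁ (bwd (G′-shadow w v) w≤G′)
        F≤G′ : F ≤ G′
        F≤G′ = atomistic λ w v w≤F → fwd (G′-shadow w v)
          (≤-trans w≤F (∨-≥ˡ F x) , λ { refl → x≰F w≤F })
        without-x : ∀ {K} → K ≤ G → ¬ x ≤ K → K ≤ G′
        without-x K≤G x≰K = atomistic λ w v w≤K →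
          fwd (G′-shadow w v) (≤-trans w≤K K≤G , λ { refl → x≰K w≤K })
        with-x : ∀ {K} → F ≤ K → K < G → ¬ x ≤ K
        with-x F≤K (K≤G , K≢G) x≤K = K≢G (≤-antisym K≤G (∨-least F≤K x≤K))
        G′⋖G : G′ ⋖′ G
        G′⋖G = ≤∧≱⇒< G′≤G (λ G≤G′ → x≰G′ (≤-trans (∨-≥ʳ F x) G≤G′)) ,
          λ K G′<K K<G → proj₂ G′<K (≤-antisym (proj₁ G′<K)
            (without-x (proj₁ K<G) (with-x (≤-trans F≤G′ (proj₁ G′<K)) K<G)))
        -- Otherwise `G′` has a facet `H` above `F`, and both middle elements of the diamond from
        -- `H` to `G` lie in `G′`, hence equal `G′`, although they are distinct.
        G′≤F : G′ ≤ F
        G′≤F = decidable-stable (G′ ≤? F) λ G′≰F → contra (lowerCover (≤∧≱⇒< F≤G′ G′≰F))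
          where
          contra : ∃[ H ] (F ≤ H × H ⋖′ G′) → ⊥
          contra (H , F≤H , H⋖G′)
            with y₁ , y₂ , y₁≢y₂ , H<y₁ , y₁<G , H<y₂ , y₂<G , _ ←
                   diamond c H G (<-≤-trans (proj₁ H⋖G′) G′≤G)
                     (trans (rank-⋖ G′⋖G) (trans (cong suc (rank-⋖ H⋖G′)) (ℕₚ.+-comm 2 (ρ H)))) =
            y₁≢y₂ (trans (is-G′ H<y₁ y₁<G) (sym (is-G′ H<y₂ y₂<G)))
            where
            is-G′ : ∀ {K} → H < K → K < G → K ≡ G′
            is-G′ {K} H<K K<G with K ≟ G′
            ... | yes eq = eq
            ... | no K≢G′ = ⊥-elim (proj₂ H⋖G′ K H<K
              (without-x (proj₁ K<G) (with-x (≤-trans F≤H (proj₁ H<K)) K<G) , K≢G′))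
        split : ∀ w → V w → w ≤ G → w ≤ F ⊎ w ≡ x
        split w v w≤G with w ≟ x
        ... | yes w≡x = inj₂ w≡x
        ... | no w≢x  = inj₁ (≤-trans (fwd (G′-shadow w v) (w≤G , w≢x)) G′≤F)

  -- Recognising the transpositions that are automorphisms.

  Swap-sym : ∀ {x y} → Swap x y → Swap y x
  Swap-sym σ = record { φ = φ ; x↦y = y↦x ; y↦x = x↦y ; others = λ u v p q → others u v q p }
    where open Swap σ

  Swap⇒∼ : ∀ {x y} → Swap x y → _∼_ P c x y
  Swap⇒∼ σ = inj₂ (φ , x↦y , y↦x , others) where open Swap σ

  ∼⇒Swap : ∀ {x y} → x ≢ y → _∼_ P c x y → Swap x y
  ∼⇒Swap x≢y (inj₁ x≡y) = ⊥-elim (x≢y x≡y)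
  ∼⇒Swap x≢y (inj₂ (φ , p , q , r)) = record { φ = φ ; x↦y = p ; y↦x = q ; others = r }

  -- Shadows containing both or neither of `x` and `y` are stable under the transposition. Only
  -- faces separating the two need checking, which is this condition in both directions.
  Exchange : El → El → Set
  Exchange x y = ∀ z → x ≤ z → ¬ y ≤ z → Face (λ w → (w ≤ z × w ≢ x) ⊎ w ≡ y)

  module _ {x y : El} (vx : V x) (vy : V y) (x≢y : x ≢ y)
           (x→y : Exchange x y) (y→x : Exchange y x) where

    private
      swap : El → El
      swap w with w ≟ x | w ≟ y
      ... | yes _ | _     = y
      ... | no _  | yes _ = x
      ... | no _  | no _  = w

      swap-x : swap x ≡ y
      swap-x with x ≟ x | x ≟ y
      ... | yes _  | _ = refl
      ... | no x≢x | _ = ⊥-elim (x≢x refl)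

      swap-y : swap y ≡ x
      swap-y with y ≟ x | y ≟ y
      ... | yes y≡x | _      = y≡x
      ... | no _    | yes _  = refl
      ... | no _    | no y≢y = ⊥-elim (y≢y refl)

      swap-others : ∀ {w} → w ≢ x → w ≢ y → swap w ≡ w
      swap-others {w} w≢x w≢y with w ≟ x | w ≟ y
      ... | yes w≡x | _       = ⊥-elim (w≢x w≡x)
      ... | no _    | yes w≡y = ⊥-elim (w≢y w≡y)
      ... | no _    | no _    = refl

      swap-V : ∀ {w} → V w → V (swap w)
      swap-V {w} v with w ≟ x | w ≟ y
      ... | yes _ | _     = vy
      ... | no _  | yes _ = vx
      ... | no _  | no _  = v

      swap-swap : ∀ w → swap (swap w) ≡ w
      swap-swap w with w ≟ x | w ≟ y
      ... | yes refl | _        = swap-y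
      ... | no _     | yes refl = swap-x
      ... | no w≢x   | no w≢y   = swap-others w≢x w≢y

      swap-elim : (Q : El → El → Set) → Q x y → Q y x → (∀ w → w ≢ x → w ≢ y → Q w w) →
                  ∀ w → Q w (swap w)
      swap-elim Q qx qy q w with w ≟ x | w ≟ y
      ... | yes refl | _        = qx
      ... | no _     | yes refl = qy
      ... | no w≢x   | no w≢y   = q w w≢x w≢y

      image : ∀ z → Face (λ w → swap w ≤ z)
      image z with x ≤? z | y ≤? z
      ... | yes p | yes q = z , λ w _ → swap-elim (λ w u → u ≤ z ⇔ w ≤ z)
              (mk⇔ (λ _ → p) (λ _ → q)) (mk⇔ (λ _ → q) (λ _ → p)) (λ _ _ _ → ⇔-refl) w
      ... | no p  | no q  = z , λ w _ → swap-elim (λ w u → u ≤ z ⇔ w ≤ z)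
              (mk⇔ (⊥-elim ∘ q) (⊥-elim ∘ p)) (mk⇔ (⊥-elim ∘ p) (⊥-elim ∘ q)) (λ _ _ _ → ⇔-refl) w
      ... | yes p | no q  = Face-resp (λ w _ → swap-elim (λ w u → ((w ≤ z × w ≢ x) ⊎ w ≡ y) ⇔ u ≤ z)
              (mk⇔ (λ { (inj₁ (_ , x≢x)) → ⊥-elim (x≢x refl) ; (inj₂ x≡y) → ⊥-elim (x≢y x≡y) }) (⊥-elim ∘ q))
              (mk⇔ (λ _ → p) (λ _ → inj₂ refl))
              (λ w w≢x w≢y → mk⇔ (λ { (inj₁ (h , _)) → h ; (inj₂ w≡y) → ⊥-elim (w≢y w≡y) }) (λ h → inj₁ (h , w≢x))) w)
              (x→y z p q)
      ... | no p  | yes q = Face-resp (λ w _ → swap-elim (λ w u → ((w ≤ z × w ≢ y) ⊎ w ≡ x) ⇔ u ≤ z)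
              (mk⇔ (λ _ → q) (λ _ → inj₂ refl))
              (mk⇔ (λ { (inj₁ (_ , y≢y)) → ⊥-elim (y≢y refl) ; (inj₂ y≡x) → ⊥-elim (x≢y (sym y≡x)) }) (⊥-elim ∘ p))
              (λ w w≢x w≢y → mk⇔ (λ { (inj₁ (h , _)) → h ; (inj₂ w≡x) → ⊥-elim (w≢x w≡x) }) (λ h → inj₁ (h , w≢y))) w)
              (y→x z q p)

      π : El → El
      π z = proj₁ (image z)

      π-shadow : ∀ {z w} → V w → w ≤ π z ⇔ swap w ≤ z
      π-shadow {z} v = ⇔-sym (proj₂ (image z) _ v)

      π-involutive : ∀ z → π (π z) ≡ z
      π-involutive z = shadow-≡ λ w v →
        π-shadow v ⇔∘ π-shadow (swap-V v) ⇔∘ mk⇔ (subst (_≤ z) (swap-swap w)) (subst (_≤ z) (sym (swap-swap w)))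

      π-mono : ∀ {a b} → a ≤ b → π a ≤ π b
      π-mono a≤b = atomistic λ w v w≤ → bwd (π-shadow v) (≤-trans (fwd (π-shadow v) w≤) a≤b)

      π-vertex : ∀ {v} → V v → π v ≡ swap v
      π-vertex {v} vv = shadow-≡ λ w vw → π-shadow vw ⇔∘ mk⇔
        (λ p → ≤-reflexive (trans (sym (swap-swap w)) (cong swap (V-minimal (swap-V vw) vv p))))
        (λ p → ≤-reflexive (trans (cong swap (V-minimal vw (swap-V vv) p)) (swap-swap v)))

    -- `π` is monotone because it acts on shadows; being an involution, it also reflects the order.
    exchange⇒Swap : Swap x y
    exchange⇒Swap = record
      { φ = record { to = π ; from = π ; from-to = π-involutive ; to-from = π-involutive
                   ; mono = λ a b → mk⇔ π-mono λ p →
                       subst (_≤ b) (π-involutive a) (subst (π (π a) ≤_) (π-involutive b) (π-mono p)) }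
      ; x↦y = trans (π-vertex vx) swap-x
      ; y↦x = trans (π-vertex vy) swap-y
      ; others = λ u v u≢x u≢y → trans (π-vertex v) (swap-others u≢x u≢y) }

-- Upper intervals are cellular pseudomanifolds.

module UpperInterval (P : FinPoset) (c : IsCPM P) (s : Fin (size P)) where
  open Theory P c

  private
    abstract
      C : Subset (size P)
      C = comprehension (s ≤?_)

      ∈-C : ∀ {z} → z Sub.∈ C ⇔ s ≤ z
      ∈-C = ∈-comprehension (s ≤?_)

  emb : Fin ∣ C ∣ → El
  emb = enum C

  s≤emb : ∀ i → s ≤ emb i
  s≤emb i = fwd ∈-C (enum-∈ C i)

  emb-injective : ∀ {i j} → emb i ≡ emb j → i ≡ j
  emb-injective = enum-injective C

  lift : ∀ {z} → s ≤ z → Fin ∣ C ∣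
  lift s≤z = index C (bwd ∈-C s≤z)

  emb-lift : ∀ {z} (s≤z : s ≤ z) → emb (lift s≤z) ≡ z
  emb-lift s≤z = enum-index C _

  ↑ : FinPoset
  ↑ = record
    { size = ∣ C ∣
    ; _≤ₚ_ = λ i j → emb i ≤ emb j
    ; isDPO = record
      { isPartialOrder = record
        { isPreorder = record
          { isEquivalence = isEquivalence
          ; reflexive = λ { refl → ≤-refl }
          ; trans = ≤-trans }
        ; antisym = λ p q → emb-injective (≤-antisym p q) }
      ; _≟_ = _≟_
      ; _≤?_ = λ i j → emb i ≤? emb j } }

  private
    N-< : ∀ {i j} → emb i < emb j → _<ₚ_ ↑ i j
    N-< (p , q) = p , λ { refl → q refl }

    M-< : ∀ {i j} → _<ₚ_ ↑ i j → emb i < emb j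
    M-< (p , q) = p , q ∘ emb-injective

    lift-< : ∀ {i z} (s≤z : s ≤ z) → emb i < z → _<ₚ_ ↑ i (lift s≤z)
    lift-< {i} s≤z p = N-< (subst (emb i <_) (sym (emb-lift s≤z)) p)

    lift-> : ∀ {i z} (s≤z : s ≤ z) → z < emb i → _<ₚ_ ↑ (lift s≤z) i
    lift-> {i} s≤z p = N-< (subst (_< emb i) (sym (emb-lift s≤z)) p)

    ρ↑ : Fin ∣ C ∣ → ℕ
    ρ↑ i = ρ (emb i) ∸ ρ s

    ρs≤ : ∀ i → ρ s ℕ.≤ ρ (emb i)
    ρs≤ i = rank-mono-≤ (s≤emb i)

    -- Whatever lies between two elements above `s` is itself above `s`.
    ⋖↑⇒⋖ : ∀ {i j} → _⋖_ ↑ i j → emb i ⋖′ emb j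
    ⋖↑⇒⋖ {i} {j} (p , q) = M-< p , λ z a b →
      let s≤z = ≤-trans (s≤emb i) (proj₁ a) in q (lift s≤z) (lift-< {i} s≤z a) (lift-> {j} s≤z b)

    rank↑-chain : ∀ {a b k} → MaxChain ↑ a b k → ρ (emb b) ≡ ρ (emb a) + k
    rank↑-chain done = sym (ℕₚ.+-identityʳ _)
    rank↑-chain {a} {b} (step {c = d} {k = k} e p) = trans (rank↑-chain p)
      (trans (cong (_+ k) (rank-⋖ (⋖↑⇒⋖ e))) (sym (ℕₚ.+-suc (ρ (emb a)) k)))

    emb-bottom : ∀ {b} → IsBottom ↑ b → emb b ≡ s
    emb-bottom {b} b-min = ≤-antisym
      (subst (emb b ≤_) (emb-lift ≤-refl) (b-min (lift ≤-refl))) (s≤emb b)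

    ∸-shift : ∀ {a b d} k → d ℕ.≤ a → a ∸ d ≡ b ∸ d + k → d ℕ.≤ b → a ≡ b + k
    ∸-shift {a} {b} {d} k d≤a eq d≤b = ℕₚ.∸-cancelʳ-≡ d≤a (ℕₚ.≤-trans d≤b (ℕₚ.m≤m+n b k))
      (trans eq (sym (ℕₚ.+-∸-comm k d≤b)))

    ∸-∸ : ∀ a d k → a ∸ d ∸ k ≡ a ∸ k ∸ d
    ∸-∸ a d k = trans (ℕₚ.∸-+-assoc a d k) (trans (cong (a ∸_) (ℕₚ.+-comm d k)) (sym (ℕₚ.∸-+-assoc a k d)))

    meet↑ : ∀ i j → ∃[ m ] IsMeet ↑ i j m
    meet↑ i j = lift s≤ ,
        subst (_≤ emb i) (sym (emb-lift s≤)) (∧-≤ˡ _ _)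
      , subst (_≤ emb j) (sym (emb-lift s≤)) (∧-≤ʳ _ _)
      , λ w p q → subst (emb w ≤_) (sym (emb-lift s≤)) (∧-greatest p q)
      where s≤ = ∧-greatest (s≤emb i) (s≤emb j)

    join↑ : ∀ i j → ∃[ m ] IsJoin ↑ i j m
    join↑ i j = lift s≤ ,
        subst (emb i ≤_) (sym (emb-lift s≤)) (∨-≥ˡ _ _)
      , subst (emb j ≤_) (sym (emb-lift s≤)) (∨-≥ʳ _ _)
      , λ w p q → subst (_≤ emb w) (sym (emb-lift s≤)) (∨-least p q)
      where s≤ = ≤-trans (s≤emb i) (∨-≥ˡ _ _)

    -- A path in the ambient lattice never leaves the interval: its facets are above `emb x`, hence
    -- above `s`, and so are the meets of neighbours. Only the ranks are shifted, by `ρ s`.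
    connected↑ : ∀ x z → _<ₚ_ ↑ x z → ρ↑ x + 2 ℕ.< ρ↑ z → Lambda.Connected ↑ ρ↑ x z
    connected↑ x z x<z long σ γ σΛ γΛ =
      restrict σ γ refl refl (connected c (emb x) (emb z) (M-< x<z) long′ (emb σ) (emb γ) (inΛ σ σΛ) (inΛ γ γΛ))
      where
      module L = Lambda P ρ (emb x) (emb z)
      module L↑ = Lambda ↑ ρ↑ x z
      long′ : ρ (emb x) + 2 ℕ.< ρ (emb z)
      long′ = ℕₚ.≰⇒> λ h → ℕₚ.<⇒≱ long
        (subst (ρ↑ z ℕ.≤_) (ℕₚ.+-∸-comm 2 (ρs≤ x)) (ℕₚ.∸-monoˡ-≤ (ρ s) h))
      -- No truncation occurs: `z` is more than two ranks above `x`, so lowering its rank by at most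
      -- 2 stays at or above `ρ s`.
      ρs≤∸ : ∀ k → k ℕ.≤ 2 → ρ s ℕ.≤ ρ (emb z) ∸ k
      ρs≤∸ k k≤2 = ℕₚ.m+n≤o⇒m≤o∸n (ρ s) (ℕₚ.≤-trans (ℕₚ.+-mono-≤ (ρs≤ x) k≤2) (ℕₚ.<⇒≤ long′))
      inΛ : ∀ i → L↑.InΛ i → L.InΛ (emb i)
      inΛ i (p , q , r) = p , q , ℕₚ.∸-cancelʳ-≡ (ρs≤ i) (ρs≤∸ 1 (s≤s z≤n)) (trans r (∸-∸ (ρ (emb z)) (ρ s) 1))
      inΛ↑ : ∀ i → L.InΛ (emb i) → L↑.InΛ i
      inΛ↑ i (p , q , r) = p , q , trans (cong (_∸ ρ s) r) (sym (∸-∸ (ρ (emb z)) (ρ s) 1))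
      restrict : ∀ i j {a b} → a ≡ emb i → b ≡ emb j → Star L.Edge a b → Star L↑.Edge i j
      restrict i j refl b≡ ε rewrite emb-injective b≡ = ε
      restrict i j refl b≡ (_◅_ {j = d} (aΛ , dΛ , a≢d , m , (m≤a , m≤d , m-max) , ρm) path) =
        (inΛ↑ i aΛ , inΛ↑ k (subst L.InΛ (sym k≡) dΛ) , (λ { refl → a≢d k≡ }) , lift s≤m ,
          ( subst (_≤ emb i) (sym (emb-lift s≤m)) m≤a
          , subst (λ d → emb (lift s≤m) ≤ d) (sym k≡) (subst (_≤ d) (sym (emb-lift s≤m)) m≤d)
          , λ w p q → subst (emb w ≤_) (sym (emb-lift s≤m)) (m-max (emb w) p (subst (emb w ≤_) k≡ q)))
          , trans (cong (λ m → ρ m ∸ ρ s) (emb-lift s≤m))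
              (trans (cong (_∸ ρ s) ρm) (sym (∸-∸ (ρ (emb z)) (ρ s) 2))))
        ◅ restrict k j (sym k≡) b≡ path
        where
        s≤d = ≤-trans (s≤emb x) (proj₁ dΛ)
        k = lift s≤d
        k≡ : emb k ≡ d
        k≡ = emb-lift s≤d
        s≤m : s ≤ m
        s≤m = m-max s (s≤emb i) s≤d

  ↑-isCPM : IsCPM ↑
  ↑-isCPM = record
    { lattice = record { inhabited = lift ≤-refl ; meet = meet↑ ; join = join↑ }
    ; rank = ρ↑
    ; ranked = λ b b-min x k p → sym (trans
        (cong (_∸ ρ s) (trans (rank↑-chain p) (cong (λ b → ρ b + k) (emb-bottom b-min))))
        (ℕₚ.m+n∸m≡n (ρ s) k))
    ; diamond = λ x z x<z eq →
        let y₁ , y₂ , y₁≢y₂ , x<y₁ , y₁<z , x<y₂ , y₂<z , only =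
              diamond c (emb x) (emb z) (M-< x<z) (∸-shift 2 (ρs≤ z) eq (ρs≤ x))
            s≤y₁ = ≤-trans (s≤emb x) (proj₁ x<y₁)
            s≤y₂ = ≤-trans (s≤emb x) (proj₁ x<y₂)
        in lift s≤y₁ , lift s≤y₂
         , (λ eq → y₁≢y₂ (trans (sym (emb-lift s≤y₁)) (trans (cong emb eq) (emb-lift s≤y₂))))
         , lift-< {x} s≤y₁ x<y₁ , lift-> {z} s≤y₁ y₁<z , lift-< {x} s≤y₂ x<y₂ , lift-> {z} s≤y₂ y₂<z
         , λ y x<y y<z → [ (λ eq → inj₁ (emb-injective (trans eq (sym (emb-lift s≤y₁)))))
                         , (λ eq → inj₂ (emb-injective (trans eq (sym (emb-lift s≤y₂))))) ]′
                         (only (emb y) (M-< x<y) (M-< y<z))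
    ; connected = connected↑ }

  V↑⇔⋖ : ∀ i → IsVertex ↑ ↑-isCPM i ⇔ s ⋖′ emb i
  V↑⇔⋖ i = mk⇔
    (λ v → rank-suc⇒⋖ (s≤emb i) (trans (∸-shift {b = ρ s} 1 (ρs≤ i) (trans v (cong (_+ 1) (sym (ℕₚ.n∸n≡0 (ρ s))))) ℕₚ.≤-refl) (ℕₚ.+-comm (ρ s) 1)))
    (λ p → trans (cong (_∸ ρ s) (rank-⋖ p)) (ℕₚ.m+n∸n≡m 1 (ρ s)))

-- Classes of vertices, and faces up to the classes they contain.

module ProperCPM (M : FinPoset) (cM : IsCPM M) (proper : IsProper M cM) where
  open Theory M cM

  private
    infix 4 _≈_
    _≈_ : El → El → Set
    _≈_ = _∼_ M cM

  ∼-sym : ∀ {x y} → x ≈ y → y ≈ x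
  ∼-sym (inj₁ x≡y) = inj₁ (sym x≡y)
  ∼-sym (inj₂ (φ , p , q , r)) = inj₂ (φ , q , p , λ u v a b → r u v b a)

  -- (x y)(y z)(x y) = (x z).
  ∼-trans : ∀ {x y z} → V x → V y → V z → x ≈ y → y ≈ z → x ≈ z
  ∼-trans {x} {y} {z} vx vy vz x∼y y∼z with x ≟ y | y ≟ z | x ≟ z
  ... | yes refl | _        | _        = y∼z
  ... | no _     | yes refl | _        = x∼y
  ... | no _     | no _     | yes refl = inj₁ refl
  ... | no x≢y   | no y≢z   | no x≢z   = inj₂
      ( record { to = a ∘ b ∘ a ; from = a⁻ ∘ b⁻ ∘ a⁻
               ; from-to = λ u → trans (cong (a⁻ ∘ b⁻) (from-to A.φ _)) (trans (cong a⁻ (from-to B.φ _)) (from-to A.φ _))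
               ; to-from = λ u → trans (cong (a ∘ b) (to-from A.φ _)) (trans (cong a (to-from B.φ _)) (to-from A.φ _))
               ; mono = λ u v → mono A.φ u v ⇔∘ mono B.φ _ _ ⇔∘ mono A.φ _ _ }
      , trans (cong (a ∘ b) A.x↦y) (trans (cong a B.x↦y) az)
      , trans (cong (a ∘ b) az) (trans (cong a B.y↦x) A.y↦x)
      , fixed )
    where
    module A = Theory.Swap (∼⇒Swap x≢y x∼y)
    module B = Theory.Swap (∼⇒Swap y≢z y∼z)
    a = to A.φ
    a⁻ = from A.φ
    b = to B.φ
    b⁻ = from B.φ
    az : a z ≡ z
    az = A.others z vz (x≢z ∘ sym) (y≢z ∘ sym)
    bx : b x ≡ x
    bx = B.others x vx x≢y x≢z
    fixed : ∀ u → V u → u ≢ x → u ≢ z → a (b (a u)) ≡ u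
    fixed u vu u≢x u≢z with u ≟ y
    ... | yes refl = trans (cong (a ∘ b) A.y↦x) (trans (cong a bx) A.x↦y)
    ... | no u≢y = trans (cong (a ∘ b) au) (trans (cong a (B.others u vu u≢y u≢z)) au)
      where au = A.others u vu u≢x u≢y

  abstract
    private
      -- The face that properness assigns to the class of `v`; it turns class membership into a
      -- decidable inequality. The value at non-vertices is arbitrary.
      K : El → El
      K v with V? v
      ... | yes vv = proj₁ (proper v vv)
      ... | no _   = v

      K-shadow : ∀ {v w} → V v → V w → w ≤ K v ⇔ v ≈ w
      K-shadow {v} {w} vv vw with V? v
      ... | yes vv′ = mk⇔ (λ p → proj₂ (bwd (proj₂ (proper v vv′) w) (vw , p)))
                          (λ p → proj₂ (fwd (proj₂ (proper v vv′) w) (vw , p)))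
      ... | no ¬vv = ⊥-elim (¬vv vv)

      K-cong : ∀ {v w} → V v → V w → v ≈ w → K v ≡ K w
      K-cong vv vw v∼w = shadow-≡ λ u vu → K-shadow vv vu ⇔∘
        mk⇔ (∼-trans vw vv vu (∼-sym v∼w)) (∼-trans vv vw vu v∼w) ⇔∘ ⇔-sym (K-shadow vw vu)

      below? : ∀ z → Dec (∃[ w ] (V w × w ≤ z))
      below? z = any? (λ w → V? w ×-dec (w ≤? z))

      -- The choice depends on the face alone, so equivalent vertices, having equal `K`, get the
      -- same representative.
      pick : El → El
      pick z with below? z
      ... | yes (w , _) = w
      ... | no _        = z

      pick-spec : ∀ {z w} → V w → w ≤ z → V (pick z) × pick z ≤ z
      pick-spec {z} vw w≤z with below? z
      ... | yes (_ , p) = p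
      ... | no none     = ⊥-elim (none (_ , vw , w≤z))

    -- The chosen representative of the class of v.
    R : El → El
    R v = pick (K v)

    R-V : ∀ {v} → V v → V (R v)
    R-V vv = proj₁ (pick-spec vv (bwd (K-shadow vv vv) (inj₁ refl)))

    private
      ∼R : ∀ {v} → V v → v ≈ R v
      ∼R vv = fwd (K-shadow vv (R-V vv)) (proj₂ (pick-spec vv (bwd (K-shadow vv vv) (inj₁ refl))))

    R≡⇔∼ : ∀ {v w} → V v → V w → R v ≡ R w ⇔ v ≈ w
    R≡⇔∼ vv vw = mk⇔
      (λ eq → ∼-trans vv (R-V vv) vw (∼R vv) (subst (_≈ _) (sym eq) (∼-sym (∼R vw))))
      (λ p → cong pick (K-cong vv vw p))

    R-R : ∀ {v} → V v → R (R v) ≡ R v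
    R-R vv = sym (bwd (R≡⇔∼ vv (R-V vv)) (∼R vv))

    classFace : ∀ {v} → V v → Face (λ w → R w ≡ R v)
    classFace {v} vv = K v , λ w vw →
      mk⇔ sym sym ⇔∘ R≡⇔∼ vv vw ⇔∘ ⇔-sym (K-shadow vv vw)

  R-Swap : ∀ {v w} → V v → V w → v ≢ w → R v ≡ R w → Swap v w
  R-Swap vv vw v≢w eq = ∼⇒Swap v≢w (fwd (R≡⇔∼ vv vw) eq)

  Full : (El → Set) → El → Set
  Full A v = ∀ w → V w → R w ≡ R v → A w

  Full? : ∀ {A} → Decidable A → Decidable (Full A)
  Full? A? v = all? (λ w → V? w →-dec ((R w ≟ R v) →-dec A? w))

  ¬Full⇒ : ∀ {A} → Decidable A → ∀ {v} → ¬ Full A v → ∃[ w ] (V w × R w ≡ R v × ¬ A w)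
  ¬Full⇒ A? {v} ¬full with any? (λ w → V? w ×-dec ((R w ≟ R v) ×-dec ¬? (A? w)))
  ... | yes p = p
  ... | no none = ⊥-elim (¬full λ w vw eq → decidable-stable (A? w) λ ¬Aw → none (w , vw , eq , ¬Aw))

  private
    -- Surplus vertices are removed one at a time. The classmate `y` lies outside `A`, hence outside
    -- every intermediate face, so `remove` applies throughout.
    shrink : ∀ {A B} → Decidable B → (∀ x → V x → B x → A x) →
      (∀ x → V x → A x → ¬ B x → ∃[ y ] (V y × R y ≡ R x × ¬ A y)) → Face A → Face B
    shrink {A} {B} B? B⊆A gap (z₀ , z₀-shadow) = Face-resp
      (λ w vw → mk⇔ (λ (_ , b) → b (∈-allFin w)) (λ b → B⊆A w vw b , λ _ → b)) (go (allFin _))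
      where
      go : ∀ l → Face (λ w → A w × (w ∈ l → B w))
      go [] = z₀ , λ w vw → mk⇔ proj₁ (λ a → a , λ ()) ⇔∘ z₀-shadow w vw
      go (x ∷ l) with go l
      ... | z , h with V? x | B? x | x ≤? z
      ... | yes vx | no ¬Bx | yes x≤z
        with y , vy , eq , ¬Ay ← gap x vx (proj₁ (bwd (h x vx) x≤z)) ¬Bx =
        Face-resp (λ w vw → mk⇔
            (λ (w≤z , w≢x) → let a , b = bwd (h w vw) w≤z in
               a , λ { (here w≡x) → ⊥-elim (w≢x w≡x) ; (there w∈) → b w∈ })
            (λ (a , b) → fwd (h w vw) (a , b ∘ there) , λ { refl → ¬Bx (b (here refl)) }))
          (remove vx vy (R-Swap vx vy (λ { refl → ¬Ay (proj₁ (bwd (h x vx) x≤z)) }) (sym eq)) x≤z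
            (λ y≤z → ¬Ay (proj₁ (bwd (h y vy) y≤z))))
      ... | yes vx | no ¬Bx | no x≰z = z , λ w vw → mk⇔
            (λ (a , b) → a , b ∘ there)
            (λ (a , b) → a , λ { (here refl) → ⊥-elim (x≰z (fwd (h w vw) (a , b))) ; (there w∈) → b w∈ }) ⇔∘ h w vw
      ... | no ¬vx | _ | _ = z , λ w vw → mk⇔
            (λ (a , b) → a , b ∘ there)
            (λ (a , b) → a , λ { (here refl) → ⊥-elim (¬vx vw) ; (there w∈) → b w∈ }) ⇔∘ h w vw
      ... | yes _ | yes Bx | _ = z , λ w vw → mk⇔
            (λ (a , b) → a , b ∘ there)
            (λ (a , b) → a , λ { (here refl) → Bx ; (there w∈) → b w∈ }) ⇔∘ h w vw

    -- Dual to `shrink`: all intermediate faces lie inside `B`, so a classmate outside `B` is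
    -- missing from each, as `add` requires.
    grow : ∀ {A B} → Decidable B → (∀ x → V x → A x → B x) →
      (∀ x → V x → B x → ¬ A x → ∃[ y ] (V y × R y ≡ R x × ¬ B y)) → Face A → Face B
    grow {A} {B} B? A⊆B gap (z₀ , z₀-shadow) = Face-resp
      (λ w vw → mk⇔ [ A⊆B w vw , proj₂ ]′ (λ b → inj₂ (∈-allFin w , b))) (go (allFin _))
      where
      go : ∀ l → Face (λ w → A w ⊎ (w ∈ l × B w))
      go [] = z₀ , λ w vw → mk⇔ [ id , (λ ()) ]′ inj₁ ⇔∘ z₀-shadow w vw
      go (x ∷ l) with go l
      ... | z , h with V? x | B? x | x ≤? z
      ... | yes vx | yes Bx | no x≰z
        with y , vy , eq , ¬By ← gap x vx Bx (x≰z ∘ fwd (h x vx) ∘ inj₁) =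
        Face-resp (λ w vw → mk⇔
            [ (λ w≤z → [ inj₁ , (λ (w∈ , b) → inj₂ (there w∈ , b)) ]′ (bwd (h w vw) w≤z))
            , (λ { refl → inj₂ (here refl , Bx) }) ]′
            λ { (inj₁ a) → inj₁ (fwd (h w vw) (inj₁ a))
              ; (inj₂ (here w≡x , _)) → inj₂ w≡x
              ; (inj₂ (there w∈ , b)) → inj₁ (fwd (h w vw) (inj₂ (w∈ , b))) })
          (add vx vy (R-Swap vx vy x≢y (sym eq)) x≢y x≰z
            (λ y≤z → ¬By ([ A⊆B y vy , proj₂ ]′ (bwd (h y vy) y≤z))))
        where
        x≢y : x ≢ y
        x≢y refl = ¬By Bx
      ... | yes vx | yes Bx | yes x≤z = z , λ w vw → mk⇔
            (λ { (inj₁ a) → fwd (h w vw) (inj₁ a) ; (inj₂ (here refl , _)) → x≤z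
               ; (inj₂ (there w∈ , b)) → fwd (h w vw) (inj₂ (w∈ , b)) })
            (λ w≤z → [ inj₁ , (λ (w∈ , b) → inj₂ (there w∈ , b)) ]′ (bwd (h w vw) w≤z))
      ... | no ¬vx | _ | _ = z , λ w vw → mk⇔
            (λ { (inj₁ a) → inj₁ a ; (inj₂ (here refl , _)) → ⊥-elim (¬vx vw)
               ; (inj₂ (there w∈ , b)) → inj₂ (w∈ , b) })
            [ inj₁ , (λ (w∈ , b) → inj₂ (there w∈ , b)) ]′ ⇔∘ h w vw
      ... | yes _ | no ¬Bx | _ = z , λ w vw → mk⇔
            (λ { (inj₁ a) → inj₁ a ; (inj₂ (here refl , b)) → ⊥-elim (¬Bx b)
               ; (inj₂ (there w∈ , b)) → inj₂ (w∈ , b) })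
            [ inj₁ , (λ (w∈ , b) → inj₂ (there w∈ , b)) ]′ ⇔∘ h w vw

  -- Whether a vertex set is a face depends only on the classes it contains: pass from A to
  -- A ∩ B by removals and from A ∩ B to B by additions.
  abstract
    sameFull : ∀ {A B} → Decidable A → Decidable B → (∀ v → V v → Full A v ⇔ Full B v) → Face A → Face B
    sameFull {A} {B} A? B? e =
      grow B? (λ _ _ → proj₂)
        -- A vertex of `B` outside `A` has a classmate outside `B`: if `B` contained its class, so
        -- would `A`.
        (λ x vx b ¬ab → ¬Full⇒ B? λ full → ¬ab (bwd (e x vx) full x vx refl , b)) ∘
      shrink {A} (λ w → A? w ×-dec B? w) (λ _ _ → proj₁)
        (λ x vx a ¬ab → ¬Full⇒ A? λ full → ¬ab (a , fwd (e x vx) full x vx refl))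

    -- Each class misses its representative, so this set contains the same classes as the empty set,
    -- the shadow of `𝟎`: none.
    nonReps : Face (λ w → R w ≢ w)
    nonReps = sameFull {λ _ → ⊥} (λ _ → no λ ()) (λ w → ¬? (R w ≟ w))
      (λ v vv → mk⇔ (λ full → ⊥-elim (full v vv refl)) (λ full → ⊥-elim (full (R v) (R-V vv) (R-R vv) (R-R vv))))
      (𝟎 , λ w vw → mk⇔ ⊥-elim (V≰𝟎 vw))

-- The quotient as an upper interval, and the representation of `M` by it.

Σ-dec : {A : Set} {B : A → Set} → (∀ a a′ → a ≡ a′) → Dec A → (∀ a → Dec (B a)) → Dec (Σ A B)
Σ-dec irr (no ¬a) B? = no (¬a ∘ proj₁)
Σ-dec {B = B} irr (yes a) B? with B? a
... | yes b = yes (a , b)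
... | no ¬b = no λ (a′ , b) → ¬b (subst B (irr a′ a) b)

∈-⋃ : ∀ {n} (L : List (Subset n)) {w} → w Sub.∈ ⋃ L ⇔ (∃[ C ] (C ∈ L × w Sub.∈ C))
∈-⋃ L = mk⇔ (find L) (λ (_ , C∈ , w∈) → insert C∈ w∈)
  where
  find : ∀ L {w} → w Sub.∈ ⋃ L → ∃[ C ] (C ∈ L × w Sub.∈ C)
  find []      w∈ = ⊥-elim (Subₚ.∉⊥ w∈)
  find (C ∷ L) w∈ with Subₚ.x∈p∪q⁻ C (⋃ L) w∈
  ... | inj₁ w∈C = C , here refl , w∈C
  ... | inj₂ w∈L with D , D∈ , w∈D ← find L w∈L = D , there D∈ , w∈D
  insert : ∀ {L C w} → C ∈ L → w Sub.∈ C → w Sub.∈ ⋃ L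
  insert (here refl) w∈ = Subₚ.x∈p∪q⁺ (inj₁ w∈)
  insert (there C∈)  w∈ = Subₚ.x∈p∪q⁺ (inj₂ (insert C∈ w∈))

-- s is the face formed by all but one vertex of every class.
module Quotient (M : FinPoset) (cM : IsCPM M) (proper : IsProper M cM)
  (s : Fin (size M))
  (s-shadow : ∀ {w} → IsVertex M cM w → ProperCPM.R M cM proper w ≢ w ⇔ _≤ₚ_ M w s) where
  open Theory M cM
  open ProperCPM M cM proper
  open UpperInterval M cM s

  -- M/∼ is the interval above s: a union of classes corresponds to its union with s.
  N : FinPoset
  N = ↑

  cN : IsCPM N
  cN = ↑-isCPM

  module TN = Theory N cN

  -- A face above `s` has all non-representatives already, so the representative alone decides.
  Full-emb : ∀ {i v} → V v → Full (_≤ emb i) v ⇔ R v ≤ emb i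
  Full-emb {i} {v} vv = mk⇔ (λ full → full (R v) (R-V vv) (R-R vv)) λ p w vw eq → below p vw eq
    where
    below : R v ≤ emb i → ∀ {w} → V w → R w ≡ R v → w ≤ emb i
    below p {w} vw eq with R w ≟ w
    ... | yes Rw≡w = subst (_≤ emb i) (trans (sym eq) Rw≡w) p
    ... | no Rw≢w  = ≤-trans (fwd (s-shadow vw) Rw≢w) (s≤emb i)

  emb-≤ : ∀ {i z} → s ≤ z → (∀ r → V r → R r ≡ r → r ≤ emb i → r ≤ z) → emb i ≤ z
  emb-≤ {i} {z} s≤z h = atomistic go
    where
    go : ∀ w → V w → w ≤ emb i → w ≤ z
    go w vw w≤ with R w ≟ w
    ... | yes Rw≡w = h w vw Rw≡w w≤
    ... | no Rw≢w  = ≤-trans (fwd (s-shadow vw) Rw≢w) s≤z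

  ≤ᴺ : ∀ {i j} → (∀ v → V v → R v ≤ emb i → R v ≤ emb j) → emb i ≤ emb j
  ≤ᴺ {i} {j} h = emb-≤ {i} (s≤emb j) λ r vr Rr≡r r≤ →
    subst (_≤ emb j) Rr≡r (h r vr (subst (_≤ emb i) (sym Rr≡r) r≤))

  abstract
    -- The witness consists of the non-representatives and the classes inside `A`. It contains no
    -- further class, since a representative can only come from the second part; so `sameFull`
    -- applies.
    Face⇒N : ∀ {A} → Decidable A → Face A → ∃[ i ] (∀ v → V v → R v ≤ emb i ⇔ Full A v)
    Face⇒N {A} A? face
      with z , h ← sameFull {A} {λ w → R w ≢ w ⊎ Full A w} A? (λ w → ¬? (R w ≟ w) ⊎-dec Full? A? w)
        (λ v vv → mk⇔
          (λ full w vw eq → inj₂ λ u vu eq′ → full u vu (trans eq′ eq))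
          (λ full → [ (λ ne → ⊥-elim (ne (R-R vv))) , (λ f u vu eq → f u vu (trans eq (sym (R-R vv)))) ]′
                      (full (R v) (R-V vv) (R-R vv)))) face
      = lift s≤z , λ v vv → mk⇔ (subst (R v ≤_) (emb-lift s≤z)) (subst (R v ≤_) (sym (emb-lift s≤z)))
          ⇔∘ ⇔-sym (h (R v) (R-V vv))
          ⇔∘ mk⇔ [ (λ ne → ⊥-elim (ne (R-R vv))) , (λ f u vu eq → f u vu (trans eq (sym (R-R vv)))) ]′
                 (λ f → inj₂ λ u vu eq → f u vu (trans eq (R-R vv)))
      where
      s≤z : s ≤ z
      s≤z = atomistic λ w vw w≤s → fwd (h w vw) (inj₁ (bwd (s-shadow vw) w≤s))

    N⇒Face : ∀ {A} i → Decidable A → (∀ v → V v → R v ≤ emb i ⇔ Full A v) → Face A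
    N⇒Face i A? h = sameFull (_≤? emb i) A? (λ v vv → Full-emb {i} vv ⇔∘ h v vv) (emb i , λ _ _ → ⇔-refl)

  -- `emb i` includes `s`, hence fragments of classes. This face keeps the whole classes only, as a
  -- face of M/∼ must.
  saturated : ∀ i → Face (λ w → R w ≤ emb i)
  saturated i = N⇒Face i (λ w → R w ≤? emb i) λ v vv →
    mk⇔ (λ p w _ eq → subst (_≤ emb i) (sym eq) p) (λ full → full v vv refl)

  private
    abstract
      -- Properness makes the class of `v` a face, and the only class it contains is itself.
      atom∃ : ∀ {v} → V v → ∃[ i ] (∀ w → V w → R w ≤ emb i ⇔ R w ≡ R v)
      atom∃ {v} vv with i , h ← Face⇒N (λ w → R w ≟ R v) (classFace vv) =
        i , λ w vw → h w vw ⇔∘ mk⇔ (λ full → full w vw refl) (λ eq u vu eq′ → trans eq′ eq)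

  atom : ∀ {v} → V v → TN.El
  atom vv = proj₁ (atom∃ vv)

  ≤atom : ∀ {v w} (vv : V v) → V w → R w ≤ emb (atom vv) ⇔ R w ≡ R v
  ≤atom vv vw = proj₂ (atom∃ vv) _ vw

  atom≤ : ∀ {v i} (vv : V v) → atom vv TN.≤ i ⇔ R v ≤ emb i
  atom≤ {v} {i} vv = mk⇔ (≤-trans (bwd (≤atom vv vv) refl))
    (λ p → ≤ᴺ {atom vv} {i} λ w vw q → subst (_≤ emb i) (sym (fwd (≤atom vv vw) q)) p)

  private
    rep≰s : ∀ {v} → V v → ¬ R v ≤ s
    rep≰s vv p = bwd (s-shadow (R-V vv)) p (R-R vv)

    rep-above-s : ∀ {z} → s < z → ∃[ w ] (V w × R w ≡ w × w ≤ z)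
    rep-above-s (s≤z , s≢z) with vertexBetween (λ z≤s → s≢z (≤-antisym s≤z z≤s))
    ... | w , vw , w≤z , w≰s = w , vw , decidable-stable (R w ≟ w) (w≰s ∘ fwd (s-shadow vw)) , w≤z

    s<atom : ∀ {v} (vv : V v) → s < emb (atom vv)
    s<atom {v} vv = ≤∧≱⇒< (s≤emb (atom vv)) λ p → rep≰s vv (≤-trans (bwd (≤atom vv vv) refl) p)

  abstract
    -- A face strictly above `s` contains a representative, and the only one in `emb (atom vv)` is
    -- `R v`.
    atom-V : ∀ {v} (vv : V v) → TN.V (atom vv)
    atom-V {v} vv = bwd (V↑⇔⋖ (atom vv)) (s<atom vv , between)
      where
      between : ∀ z → s < z → z < emb (atom vv) → ⊥
      between z s<z z<atom with w , vw , Rw≡w , w≤z ← rep-above-s s<z =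
        proj₂ z<atom (≤-antisym (proj₁ z<atom) (emb-≤ {atom vv} (proj₁ s<z) λ r vr Rr≡r r≤ →
          subst (_≤ z) (trans (sym Rw≡w) (trans (class vw (≤-trans (≤-reflexive Rw≡w) (≤-trans w≤z (proj₁ z<atom))))
            (trans (sym (class vr (≤-trans (≤-reflexive Rr≡r) r≤))) Rr≡r))) w≤z))
        where
        class : ∀ {w} → V w → R w ≤ emb (atom vv) → R w ≡ R v
        class vw = fwd (≤atom vv vw)

  abstract
    V⇒atom : ∀ {i} → TN.V i → ∃[ v ] Σ (V v) λ vv → R v ≡ v × i ≡ atom vv
    V⇒atom {i} vi = let s<i , none = fwd (V↑⇔⋖ i) vi
                        w , vw , Rw≡w , w≤i = rep-above-s s<i
                    in w , vw , Rw≡w , sym (emb-injective (decidable-stable (_ ≟ _) λ ne →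
                         none (emb (atom vw)) (s<atom vw)
                           (bwd (atom≤ {i = i} vw) (≤-trans (≤-reflexive Rw≡w) w≤i) , ne)))

  atom-≡ : ∀ {v w} (vv : V v) (vw : V w) → atom vv ≡ atom vw ⇔ R v ≡ R w
  atom-≡ vv vw = mk⇔
    (λ eq → fwd (≤atom vw vv) (subst (λ i → _ ≤ emb i) eq (bwd (≤atom vv vv) refl)))
    (λ eq → emb-injective (≤-antisym
      (bwd (atom≤ {i = atom vw} vv) (bwd (≤atom vw vv) eq)) (bwd (atom≤ {i = atom vv} vw) (bwd (≤atom vv vw) (sym eq)))))

  V∋⇒≡atom : ∀ {i v} (vv : V v) → TN.V i → R v ≤ emb i → i ≡ atom vv
  V∋⇒≡atom vv vi p with w , vw , _ , refl ← V⇒atom vi = bwd (atom-≡ vw vv) (sym (fwd (≤atom vw vv) p))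

  TN-Face⇒ : ∀ {A} → TN.Face A → ∃[ i ] (∀ {v} (vv : V v) → R v ≤ emb i ⇔ A (atom vv))
  TN-Face⇒ (i , h) = i , λ vv → ⇔-sym (atom≤ {i = i} vv) ⇔∘ ⇔-sym (h (atom vv) (atom-V vv))

  module _ {x y : El} (vx : V x) (vy : V y) (i≢j : atom vx ≢ atom vy)
           (σ : TN.Swap (atom vx) (atom vy)) where
    abstract
      -- The class of `x` may be absent from `b`: in `exchange` the face `z` can contain `x` without
      -- its whole class.
      removeClass : ∀ b → ¬ R y ≤ emb b →
        ∃[ b₁ ] (∀ v → V v → R v ≤ emb b₁ ⇔ (R v ≤ emb b × R v ≢ R x))
      removeClass b Ry≰b = go (R x ≤? emb b)
        where
        go : Dec (R x ≤ emb b) → ∃[ b₁ ] (∀ v → V v → R v ≤ emb b₁ ⇔ (R v ≤ emb b × R v ≢ R x))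
        go (no Rx≰b) = b , λ v vv → mk⇔ (λ p → p , λ eq → Rx≰b (subst (_≤ emb b) eq p)) proj₁
        go (yes Rx≤b) =
          let b₁ , h = TN-Face⇒ {λ k → k TN.≤ b × k ≢ atom vx} (TN.remove (atom-V vx) (atom-V vy) σ {b}
                         (bwd (atom≤ {i = b} vx) Rx≤b) (Ry≰b ∘ fwd (atom≤ {i = b} vy)))
          in b₁ , λ v vv → h vv ⇔∘ mk⇔
               (λ (p , q) → fwd (atom≤ {i = b} vv) p , q ∘ bwd (atom-≡ vv vx))
               (λ (p , q) → bwd (atom≤ {i = b} vv) p , q ∘ fwd (atom-≡ vv vx))

      addClass : ∀ b → ¬ R x ≤ emb b → ¬ R y ≤ emb b →
        ∃[ b₁ ] (∀ v → V v → R v ≤ emb b₁ ⇔ (R v ≤ emb b ⊎ R v ≡ R x))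
      addClass b Rx≰b Ry≰b =
        let b₁ , h = TN-Face⇒ {λ k → k TN.≤ b ⊎ k ≡ atom vx} (TN.add (atom-V vx) (atom-V vy) σ i≢j {b}
                       (Rx≰b ∘ fwd (atom≤ {i = b} vx)) (Ry≰b ∘ fwd (atom≤ {i = b} vy)))
        in b₁ , λ v vv → h vv ⇔∘ mk⇔
             [ inj₁ ∘ fwd (atom≤ {i = b} vv) , inj₂ ∘ fwd (atom-≡ vv vx) ]′
             [ inj₁ ∘ bwd (atom≤ {i = b} vv) , inj₂ ∘ bwd (atom-≡ vv vx) ]′

  private
    -- In N the class of x can be removed from, and the class of y added to, the classes
    -- contained in a face of M.
    exchange : ∀ {x y} (vx : V x) (vy : V y) → atom vx ≢ atom vy →
      TN.Swap (atom vx) (atom vy) → Exchange x y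
    exchange {x} {y} vx vy i≢j σ z x≤z y≰z =
      -- `b` holds the classes inside `z`. Deleting `x` can break only its own class, which `b₁`
      -- drops; inserting `y` can complete only its own class, and whether it does is decided by
      -- `Full? A? y`.
      let b , b-spec = Face⇒N (_≤? z) (z , λ _ _ → ⇔-refl)
          Ry≰b = λ p → y≰z (fwd (b-spec y vy) p y vy refl)
          b₁ , b₁-spec = removeClass vx vy i≢j σ b Ry≰b
          b₂ , b₂-spec = extend b₁ (λ p → proj₂ (fwd (b₁-spec x vx) p) refl)
                                   (λ p → Ry≰b (proj₁ (fwd (b₁-spec y vy) p))) (Full? A? y)
      in N⇒Face b₂ A? λ v vv → b₂-spec v vv ⇔∘ mk⇔
           (to′ vv ∘ [ (λ p → let q , ne = fwd (b₁-spec v vv) p in inj₁ (fwd (b-spec v vv) q , ne)) , inj₂ ]′)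
           ([ (λ (q , ne) → inj₁ (bwd (b₁-spec v vv) (bwd (b-spec v vv) q , ne))) , inj₂ ]′ ∘ from′ vv)
      where
      Rx≢Ry : R x ≢ R y
      Rx≢Ry = i≢j ∘ bwd (atom-≡ vx vy)

      A : El → Set
      A w = (w ≤ z × w ≢ x) ⊎ w ≡ y
      A? : Decidable A
      A? w = ((w ≤? z) ×-dec ¬? (w ≟ x)) ⊎-dec (w ≟ y)

      extend : ∀ b → ¬ R x ≤ emb b → ¬ R y ≤ emb b → Dec (Full A y) →
        ∃[ b₁ ] (∀ v → V v → R v ≤ emb b₁ ⇔ (R v ≤ emb b ⊎ (R v ≡ R y × Full A y)))
      extend b _ _ (no ¬full) = b , λ v vv → mk⇔ inj₁ [ id , (λ (_ , full) → ⊥-elim (¬full full)) ]′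
      extend b Rx≰b Ry≰b (yes full) =
        let b₁ , h = addClass vy vx (i≢j ∘ sym) (TN.Swap-sym σ) b Ry≰b Rx≰b
        in b₁ , λ v vv → h v vv ⇔∘ mk⇔ [ inj₁ , (λ p → inj₂ (p , full)) ]′ [ inj₁ , inj₂ ∘ proj₁ ]′

      to′ : ∀ {v} → V v → (Full (_≤ z) v × R v ≢ R x) ⊎ (R v ≡ R y × Full A y) → Full A v
      to′ vv (inj₁ (p , q)) w vw eq = inj₁ (p w vw eq , λ { refl → q (sym eq) })
      to′ vv (inj₂ (p , full)) w vw eq = full w vw (trans eq p)

      from′ : ∀ {v} → V v → Full A v → (Full (_≤ z) v × R v ≢ R x) ⊎ (R v ≡ R y × Full A y)
      from′ {v} vv full with R v ≟ R y
      ... | yes eq = inj₂ (eq , λ w vw e → full w vw (trans e (sym eq)))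
      ... | no ne  = inj₁ (in-z , λ eq → not-x (full x vx (sym eq)))
        where
        not-x : ¬ A x
        not-x (inj₁ (_ , x≢x)) = x≢x refl
        not-x (inj₂ x≡y) = Rx≢Ry (cong R x≡y)
        in-z : Full (_≤ z) v
        in-z w vw eq with full w vw eq
        ... | inj₁ (w≤z , _) = w≤z
        ... | inj₂ refl = ⊥-elim (ne (sym eq))

  N-primitive : IsPrimitive N cN
  N-primitive i j vi vj i∼j with i ≟ j
  ... | yes i≡j = i≡j
  ... | no i≢j with x , vx , _ , refl ← V⇒atom vi | y , vy , _ , refl ← V⇒atom vj =
    bwd (atom-≡ vx vy) (bwd (R≡⇔∼ vx vy) (Swap⇒∼ (exchange⇒Swap vx vy x≢y
      (exchange vx vy i≢j σ) (exchange vy vx (i≢j ∘ sym) (TN.Swap-sym σ)))))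
    where
    σ = TN.∼⇒Swap i≢j i∼j
    x≢y : x ≢ y
    x≢y eq = i≢j (bwd (atom-≡ vx vy) (cong R eq))

  abstract
    private
      classOf : El → Subset (size M)
      classOf v = comprehension (λ w → V? w ×-dec (R w ≟ R v))

      ∈-classOf : ∀ {v w} → w Sub.∈ classOf v ⇔ (V w × R w ≡ R v)
      ∈-classOf {v} = ∈-comprehension (λ w → V? w ×-dec (R w ≟ R v))

      classOf-IsClass : ∀ {v} → V v → IsClass M cM (classOf v)
      classOf-IsClass {v} vv = v , vv , λ w → ∈-classOf {v} ⇔∘
        mk⇔ (λ (vw , eq) → vw , fwd (R≡⇔∼ vv vw) (sym eq)) (λ (vw , p) → vw , sym (bwd (R≡⇔∼ vv vw) p))

      IsClass⇒≡ : ∀ {C w} → IsClass M cM C → w Sub.∈ C → C ≡ classOf w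
      IsClass⇒≡ {C} {w} (v , vv , h) w∈ with vw , v∼w ← fwd (h w) w∈ = Subₚ.⊆-antisym
        (λ u∈ → let vu , v∼u = fwd (h _) u∈ in
          bwd (∈-classOf {w}) (vu , trans (sym (bwd (R≡⇔∼ vv vu) v∼u)) (bwd (R≡⇔∼ vv vw) v∼w)))
        (λ u∈ → let vu , eq = fwd (∈-classOf {w}) u∈ in
          bwd (h _) (vu , fwd (R≡⇔∼ vv vu) (trans (bwd (R≡⇔∼ vv vw) v∼w) (sym eq))))

      classOf-R : ∀ {v} → V v → classOf (R v) ≡ classOf v
      classOf-R {v} vv = IsClass⇒≡ (classOf-IsClass (R-V vv)) (bwd (∈-classOf {R v}) (vv , sym (R-R vv)))

      Rep≤? : ∀ i → Decidable (λ w → V w × R w ≡ w × w ≤ emb i)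
      Rep≤? i w = V? w ×-dec ((R w ≟ w) ×-dec (w ≤? emb i))

    classes : TN.El → List (Subset (size M))
    classes i = map classOf (filter (Rep≤? i) (allFin _))

    private
      ∈-classes⁺ : ∀ {i v} → V v → R v ≤ emb i → classOf v ∈ classes i
      ∈-classes⁺ {i} {v} vv p = ∈-map∘filter⁺ classOf (Rep≤? i)
        (R v , ∈-allFin _ , sym (classOf-R vv) , R-V vv , R-R vv , p)

      ∈-classes⁻ : ∀ {i C} → C ∈ classes i → ∃[ v ] (V v × R v ≤ emb i × C ≡ classOf v)
      ∈-classes⁻ {i} C∈ with v , _ , refl , vv , Rv≡v , v≤ ← ∈-map∘filter⁻ classOf (Rep≤? i) {xs = allFin _} C∈ =
        v , vv , subst (_≤ emb i) (sym Rv≡v) v≤ , refl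

    ∈-⋃classes : ∀ {i w} → w Sub.∈ ⋃ (classes i) ⇔ (V w × R w ≤ emb i)
    ∈-⋃classes {i} {w} = ∈-⋃ (classes i) ⇔∘ mk⇔ there′ back
      where
      there′ : ∃[ C ] (C ∈ classes i × w Sub.∈ C) → V w × R w ≤ emb i
      there′ (C , C∈ , w∈) with v , vv , p , refl ← ∈-classes⁻ {i} C∈ =
        let vw , eq = fwd (∈-classOf {v}) w∈ in vw , subst (_≤ emb i) (sym eq) p
      back : V w × R w ≤ emb i → ∃[ C ] (C ∈ classes i × w Sub.∈ C)
      back (vw , p) = classOf w , ∈-classes⁺ {i} vw p , bwd (∈-classOf {w}) (vw , refl)

  quotIso : QuotIso M cM N
  quotIso = classes , isFace , onto , λ i j → mk⇔ (λ i≤j {C} → mono⇒ {i} {j} i≤j {C}) (mono⇐ {i} {j})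
    where
    isFace : ∀ i → QuotFace M cM (classes i)
    isFace i = All.tabulate (λ C∈ → let v , vv , _ , eq = ∈-classes⁻ {i} C∈ in
                 subst (IsClass M cM) (sym eq) (classOf-IsClass vv))
      , proj₁ (saturated i) , λ w → ∈-⋃classes {i} ⇔∘
          mk⇔ (λ (vw , p) → vw , fwd (proj₂ (saturated i) w vw) p) (λ (vw , p) → vw , bwd (proj₂ (saturated i) w vw) p)

    mono⇒ : ∀ {i j} → emb i ≤ emb j → ∀ {C} → C ∈ classes i → C ∈ classes j
    mono⇒ {i} {j} i≤j C∈ with v , vv , p , refl ← ∈-classes⁻ {i} C∈ = ∈-classes⁺ {j} vv (≤-trans p i≤j)

    mono⇐ : ∀ {i j} → (∀ {C} → C ∈ classes i → C ∈ classes j) → emb i ≤ emb j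
    mono⇐ {i} {j} h = ≤ᴺ {i} {j} λ v vv p →
      proj₂ (fwd (∈-⋃classes {j}) (bwd (∈-⋃ (classes j))
        (classOf v , h (∈-classes⁺ {i} vv p) , bwd (∈-classOf {v}) (vv , refl))))

    onto : ∀ L → QuotFace M cM L → ∃[ i ] ((∀ {C} → C ∈ classes i → C ∈ L) × (∀ {C} → C ∈ L → C ∈ classes i))
    onto L (areClasses , z , z-shadow) with i , h ← Face⇒N (_≤? z) (z , λ _ _ → ⇔-refl) = i , ⇒L , ⇐L
      where
      below : ∀ {v C} → C ∈ L → v Sub.∈ C → v ≤ z
      below C∈ v∈ = proj₂ (fwd (z-shadow _) (bwd (∈-⋃ L) (_ , C∈ , v∈)))
      ⇒L : ∀ {C} → C ∈ classes i → C ∈ L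
      ⇒L C∈ with v , vv , p , refl ← ∈-classes⁻ {i} C∈
        with D , D∈ , v∈ ← fwd (∈-⋃ L) (bwd (z-shadow v) (vv , fwd (h v vv) p v vv refl)) =
        subst (_∈ L) (IsClass⇒≡ (All.lookup areClasses D∈) v∈) D∈
      ⇐L : ∀ {C} → C ∈ L → C ∈ classes i
      ⇐L {C} C∈ with v , vv , hv ← All.lookup areClasses C∈
        with v∈ ← bwd (hv v) (vv , inj₁ refl) with refl ← IsClass⇒≡ {C} (v , vv , hv) v∈ =
        ∈-classes⁺ {i} vv (bwd (h v vv) λ w vw eq → below C∈ (bwd (∈-classOf {v}) (vw , eq)))

  -- At a vertex of `N` the union runs over a single class, so this is the size of that class.
  f : Vertex N cN → ℕ
  f = quotSize M cM cN quotIso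

  private
    G : Set
    G = Ground N cN f

    g : G → El
    g ((i , _) , k) = enum (⋃ (classes i)) k

    g-∈ : ∀ x k → V (g (x , k)) × R (g (x , k)) ≤ emb (proj₁ x)
    g-∈ (i , _) k = fwd (∈-⋃classes {i}) (enum-∈ (⋃ (classes i)) k)

    g⁻¹ : ∀ {w} → V w → G
    g⁻¹ vw = (atom vw , atom-V vw) , index _ (bwd (∈-⋃classes {atom vw}) (vw , bwd (≤atom vw vw) refl))

    g-g⁻¹ : ∀ {w} (vw : V w) → g (g⁻¹ vw) ≡ w
    g-g⁻¹ vw = enum-index _ _

    g-injective : ∀ {u u′} → g u ≡ g u′ → u ≡ u′
    g-injective {(i , vi) , k} {(j , vj) , l} eq
      with vw , p ← g-∈ (i , vi) k | _ , q ← g-∈ (j , vj) l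
      with refl ← trans (V∋⇒≡atom vw vi p) (sym (V∋⇒≡atom vw vj (subst (λ w → R w ≤ emb j) (sym eq) q)))
      with refl ← ℕₚ.≡-irrelevant vi vj
      = cong ((i , vi) ,_) (enum-injective (⋃ (classes i)) eq)

  1≤f : ∀ x → 1 ℕ.≤ f x
  1≤f (i , vi) with w , vw , _ , refl ← V⇒atom vi = pos (proj₂ (g⁻¹ vw))
    where
    pos : ∀ {n} → Fin n → 1 ℕ.≤ n
    pos zero    = s≤s z≤n
    pos (suc _) = s≤s z≤n

  -- Through `g` the ground set becomes the vertex set of `M` and each V_x a class. On both sides
  -- the faces are then the vertex sets whose full classes form an element of `N`.
  isoAngle : IsoAngle N cN f M
  isoAngle = θ , isFace , onto , λ a b → mk⇔
      (λ a≤b u p → bwd (∈θ b u) (≤-trans (fwd (∈θ a u) p) a≤b))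
      (λ h → atomistic λ w vw w≤a → subst (_≤ b) (g-g⁻¹ vw)
        (fwd (∈θ b (g⁻¹ vw)) (h (g⁻¹ vw) (bwd (∈θ a (g⁻¹ vw)) (subst (_≤ a) (sym (g-g⁻¹ vw)) w≤a)))))
    where
    θ : El → G → Bool
    θ z u = does (g u ≤? z)

    ∈θ : ∀ z u → T (θ z u) ⇔ g u ≤ z
    ∈θ z u = T-does (g u ≤? z)

    isFace : ∀ z → AngleFace N cN f (θ z)
    isFace z with i , h ← Face⇒N (_≤? z) (z , λ _ _ → ⇔-refl) = i , spec
      where
      spec : ∀ x → (∀ k → T (θ z (x , k))) ⇔ (proj₁ x TN.≤ i)
      spec (_ , vx) with v , vv , _ , refl ← V⇒atom vx = mk⇔
        (λ full → bwd (atom≤ {i = i} vv) (bwd (h v vv) λ w vw eq →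
          let w∈ = bwd (∈-⋃classes {atom vv}) (vw , bwd (≤atom vv vw) eq) in
          subst (_≤ z) (enum-index _ w∈) (fwd (∈θ z ((atom vv , vx) , index _ w∈)) (full (index _ w∈)))))
        (λ p k → let vw , q = g-∈ (atom vv , vx) k in
          bwd (∈θ z ((atom vv , vx) , k)) (fwd (h v vv) (fwd (atom≤ {i = i} vv) p) _ vw (fwd (≤atom vv vw) q)))

    onto : ∀ A → AngleFace N cN f A → ∃[ z ] ((∀ u → T (θ z u) → T (A u)) × (∀ u → T (A u) → T (θ z u)))
    onto A (i , h) = proj₁ face
      , (λ u p → subst (T ∘ A) (g-injective (g-g⁻¹ _)) (proj₂ (bwd (shadow u) (fwd (∈θ _ u) p))))
      , (λ u p → bwd (∈θ _ u) (fwd (shadow u) (g-V u , subst (T ∘ A) (sym (g-injective (g-g⁻¹ _))) p)))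
      where
      B : El → Set
      B w = Σ (V w) λ vw → T (A (g⁻¹ vw))
      B? : Decidable B
      B? w = Σ-dec ℕₚ.≡-irrelevant (V? w) (λ vw → T? (A (g⁻¹ vw)))
      spec : ∀ v → V v → R v ≤ emb i ⇔ Full B v
      spec v vv = ⇔-sym (atom≤ {i = i} vv) ⇔∘ ⇔-sym (h (atom vv , atom-V vv)) ⇔∘ mk⇔
        (λ full w vw eq → vw , in-A full vw eq)
        (λ full k → let vw , q = g-∈ (atom vv , atom-V vv) k
                        _ , p = full _ vw (fwd (≤atom vv vw) q)
                    in subst (T ∘ A) (g-injective (g-g⁻¹ _)) p)
        where
        in-A : (∀ k → T (A ((atom vv , atom-V vv) , k))) → ∀ {w} (vw : V w) → R w ≡ R v → T (A (g⁻¹ vw))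
        in-A full vw eq = let w∈ = bwd (∈-⋃classes {atom vv}) (vw , bwd (≤atom vv vw) eq) in
          subst (T ∘ A) (g-injective {(atom vv , atom-V vv) , index _ w∈} {g⁻¹ vw}
            (trans (enum-index _ w∈) (sym (g-g⁻¹ vw)))) (full (index _ w∈))
      face : Face B
      face = N⇒Face i B? spec
      g-V : ∀ u → V (g u)
      g-V (x , k) = proj₁ (g-∈ x k)
      shadow : ∀ u → B (g u) ⇔ g u ≤ proj₁ face
      shadow u = proj₂ face (g u) (g-V u)

-- From an isomorphism with ⟨N,f⟩ to a bijection on vertices.

-- M ≅ ⟨N,f⟩, expressed by the induced bijection p from the ground set of ⟨N,f⟩ to the vertices of M.
record Coordinates (M : FinPoset) (cM : IsCPM M) (N : FinPoset) (cN : IsCPM N)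
                   (f : Vertex N cN → ℕ) : Set₁ where
  open Theory M cM
  field
    p           : Ground N cN f → El
    p-V         : ∀ u → V (p u)
    p-injective : ∀ {u v} → p u ≡ p v → u ≡ v
    p-onto      : ∀ {w} → V w → ∃[ u ] p u ≡ w
    toFace      : ∀ {A : Ground N cN f → Set} → Decidable A → ∀ z →
                  (∀ x → (∀ k → A (x , k)) ⇔ _≤ₚ_ N (proj₁ x) z) → ∃[ y ] (∀ u → p u ≤ y ⇔ A u)
    fromFace    : ∀ y → ∃[ z ] (∀ x → (∀ k → p (x , k) ≤ y) ⇔ _≤ₚ_ N (proj₁ x) z)

module _ (N : FinPoset) (cN : IsCPM N) where

  Vertex-≡ : {x y : Vertex N cN} → proj₁ x ≡ proj₁ y → x ≡ y
  Vertex-≡ {x , vx} {_ , vy} refl = cong (x ,_) (ℕₚ.≡-irrelevant vx vy)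

  Ground-≟ : ∀ f (u v : Ground N cN f) → Dec (u ≡ v)
  Ground-≟ f ((x , vx) , k) ((y , vy) , l) with x ≟ y
  ... | no x≢y = no λ { refl → x≢y refl }
  ... | yes refl with refl ← ℕₚ.≡-irrelevant vx vy with k ≟ l
  ...   | yes refl = yes refl
  ...   | no k≢l   = no λ { refl → k≢l refl }

  anyGround? : ∀ f {A : Ground N cN f → Set} → Decidable A → Dec (∃ A)
  anyGround? f {A} A? with any? (λ x → Σ-dec {B = λ vx → ∃[ k ] A ((x , vx) , k)} ℕₚ.≡-irrelevant
                                  (rank cN x ℕ.≟ 1) (λ vx → any? (λ k → A? ((x , vx) , k))))
  ... | yes (x , vx , k , a) = yes (((x , vx) , k) , a)
  ... | no none = no λ (((x , vx) , k) , a) → none (x , vx , k , a)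

module _ (M : FinPoset) (cM : IsCPM M) (N : FinPoset) (cN : IsCPM N) (f : Vertex N cN → ℕ)
         (1≤f : ∀ x → 1 ℕ.≤ f x) (iso : IsoAngle N cN f M) where
  open Theory M cM

  private
    module TN = Theory N cN
    G = Ground N cN f

    _≟ᴳ_ : (u v : G) → Dec (u ≡ v)
    _≟ᴳ_ = Ground-≟ N cN f

    k₀ : ∀ x → Fin (f x)
    k₀ x = fromℕ< (1≤f x)

    θ = proj₁ iso
    θ-face = proj₁ (proj₂ iso)
    θ-onto = proj₁ (proj₂ (proj₂ iso))
    θ-mono = proj₂ (proj₂ (proj₂ iso))

    infix 4 _∋_
    _∋_ : El → G → Set
    z ∋ u = T (θ z u)

    fill : ∀ {A : G → Set} → Decidable A → ∀ z →
           (∀ x → (∀ k → A (x , k)) ⇔ proj₁ x TN.≤ z) → ∃[ y ] (∀ u → y ∋ u ⇔ A u)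
    fill A? z h =
      let y , θy⊆A , A⊆θy = θ-onto (does ∘ A?) (z , λ x → mk⇔
            (λ a → fwd (h x) λ k → fwd (T-does (A? _)) (a k)) (λ q k → bwd (T-does (A? _)) (bwd (h x) q k)))
      in y , λ u → mk⇔ (fwd (T-does (A? u)) ∘ θy⊆A u) (A⊆θy u ∘ bwd (T-does (A? u)))

    -- Positivity of `f` is what keeps the empty set from containing some V_x.
    empty : ∃[ y ] (∀ u → y ∋ u ⇔ ⊥)
    empty = fill (λ _ → no λ ()) TN.𝟎 λ x → mk⇔ (λ a → ⊥-elim (a (k₀ x))) (λ q → ⊥-elim (TN.V≰𝟎 (proj₂ x) q))

    -- A singleton contains at most one V_x: it lies over the vertex `x₀` if it is all of V_x₀, and
    -- over the bottom of `N` otherwise.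
    point : ∀ u → ∃[ y ] (∀ v → y ∋ v ⇔ v ≡ u)
    point u@(x₀ , k) = go (all? λ k → (x₀ , k) ≟ᴳ u)
      where
      go : Dec (∀ k → (x₀ , k) ≡ u) → ∃[ y ] (∀ v → y ∋ v ⇔ v ≡ u)
      go (yes all) = fill (_≟ᴳ u) (proj₁ x₀) λ x → mk⇔
        (λ a → TN.≤-reflexive (cong (proj₁ ∘ proj₁) (a (k₀ x)))) (λ q → back (V-≡ x q))
        where
        V-≡ : ∀ x → proj₁ x TN.≤ proj₁ x₀ → x ≡ x₀
        V-≡ x q = Vertex-≡ N cN (TN.V-minimal (proj₂ x) (proj₂ x₀) q)
        back : ∀ {x} → x ≡ x₀ → ∀ k → (x , k) ≡ u
        back refl = all
      go (no ¬all) = fill (_≟ᴳ u) TN.𝟎 λ x → mk⇔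
        (λ a → ⊥-elim (¬all (single a (cong proj₁ (a (k₀ x)))))) (λ q → ⊥-elim (TN.V≰𝟎 (proj₂ x) q))
        where
        single : ∀ {x} → (∀ k → (x , k) ≡ u) → x ≡ x₀ → ∀ k → (x₀ , k) ≡ u
        single a refl = a

    p : G → El
    p u = proj₁ (point u)

    p∋ : ∀ u v → p u ∋ v ⇔ v ≡ u
    p∋ u = proj₂ (point u)

    p≤ : ∀ {u z} → p u ≤ z ⇔ z ∋ u
    p≤ {u} {z} = mk⇔ (λ q → fwd (θ-mono (p u) z) q u (bwd (p∋ u u) refl))
      (λ z∋u → bwd (θ-mono (p u) z) λ v pu∋v → subst (z ∋_) (sym (fwd (p∋ u v) pu∋v)) z∋u)

    no-point⇒𝟎 : ∀ {z} → (∀ u → ¬ z ∋ u) → z ≤ 𝟎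
    no-point⇒𝟎 {z} h = bwd (θ-mono z 𝟎) λ u z∋u → ⊥-elim (h u z∋u)

    p-V : ∀ u → V (p u)
    p-V u = 𝟎⋖⇒V (≤∧≱⇒< (𝟎-min _) (λ q → fwd (proj₂ empty u) (fwd p≤ (≤-trans q (𝟎-min _)))) ,
      λ z 𝟎<z z<pu → proj₂ 𝟎<z (≤-antisym (proj₁ 𝟎<z) (no-point⇒𝟎 λ v z∋v →
        proj₂ z<pu (≤-antisym (proj₁ z<pu) (bwd p≤
          (subst (z ∋_) (fwd (p∋ u v) (fwd (θ-mono z (p u)) (proj₁ z<pu) v z∋v)) z∋v))))))

    p-onto : ∀ {w} → V w → ∃[ u ] p u ≡ w
    p-onto {w} vw = go (anyGround? N cN f (λ u → T? (θ w u)))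
      where
      go : Dec (∃ (w ∋_)) → ∃[ u ] p u ≡ w
      go (yes (u , w∋u)) = u , V-minimal (p-V u) vw (bwd p≤ w∋u)
      go (no none) = ⊥-elim (V≰𝟎 vw (no-point⇒𝟎 λ u w∋u → none (u , w∋u)))

  coordinates : Coordinates M cM N cN f
  coordinates = record
    { p = p
    ; p-V = p-V
    ; p-injective = λ {u} {v} eq → fwd (p∋ v u) (subst (_∋ u) eq (bwd (p∋ u u) refl))
    ; p-onto = p-onto
    ; toFace = λ A? z h → let y , y∋ = fill A? z h in y , λ u → p≤ ⇔∘ y∋ u
    ; fromFace = λ y → let z , h = θ-face y in z , λ x →
        mk⇔ (λ q k → fwd p≤ (q k)) (λ q k → bwd p≤ (q k)) ⇔∘ h x }

-- Uniqueness of the representation.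

module Uniqueness (M : FinPoset) (cM : IsCPM M) (proper : IsProper M cM)
  (s : Fin (size M))
  (s-shadow : ∀ {w} → IsVertex M cM w → ProperCPM.R M cM proper w ≢ w ⇔ _≤ₚ_ M w s)
  (N′ : FinPoset) (cN′ : IsCPM N′) (f′ : Vertex N′ cN′ → ℕ)
  (N′-primitive : IsPrimitive N′ cN′) (1≤f′ : ∀ x → 1 ℕ.≤ f′ x)
  (coords : Coordinates M cM N′ cN′ f′) where

  open Theory M cM
  open ProperCPM M cM proper
  open Quotient M cM proper s s-shadow
  open UpperInterval M cM s using (emb; emb-injective)
  open Coordinates coords
  private
    module T′ = Theory N′ cN′
    G = Ground N′ cN′ f′

    _≟ᴳ_ : (u v : G) → Dec (u ≡ v)
    _≟ᴳ_ = Ground-≟ N′ cN′ f′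

    k₀ : ∀ x → Fin (f′ x)
    k₀ x = fromℕ< (1≤f′ x)

    comp : G → T′.El
    comp u = proj₁ (proj₁ u)

    onPoints : ∀ {B} → ∃[ y ] (∀ u → p u ≤ y ⇔ B (p u)) → Face B
    onPoints {B} (y , h) = y , λ w vw → let u , eq = p-onto vw in
      subst (λ w → B w ⇔ w ≤ y) eq (⇔-sym (h u))

    -- A set missing a point of V_x does not contain V_x, so exchanging two points of V_x does not
    -- change which of the sets V_t it contains.
    exchange-same : ∀ x {k l} → k ≢ l → Exchange (p (x , k)) (p (x , l))
    exchange-same x {k} {l} k≢l y pu≤y pv≰y =
      let z , h = fromFace y
      in onPoints (let y′ , h′ = toFace A? z λ t → A⇔ t ⇔∘ h t
                   in y′ , λ t → h′ t ⇔∘ mk⇔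
                        [ (λ (q , ne) → inj₁ (q , ne ∘ p-injective)) , inj₂ ∘ cong p ]′
                        [ (λ (q , ne) → inj₁ (q , ne ∘ cong p)) , inj₂ ∘ p-injective ]′)
      where
      u v : G
      u = x , k
      v = x , l
      A : G → Set
      A t = (p t ≤ y × t ≢ u) ⊎ t ≡ v
      A? : Decidable A
      A? t = ((p t ≤? y) ×-dec ¬? (t ≟ᴳ u)) ⊎-dec (t ≟ᴳ v)
      u≢v : u ≢ v
      u≢v refl = k≢l refl
      u∉A : ¬ A u
      u∉A = [ (λ (_ , ne) → ne refl) , u≢v ]′
      A⇔ : ∀ t → (∀ m → A (t , m)) ⇔ (∀ m → p (t , m) ≤ y)
      A⇔ t = mk⇔
        (λ a m → [ proj₁ , (λ eq → ⊥-elim (u∉A (at (cong proj₁ eq) a))) ]′ (a m))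
        (λ q m → inj₁ (q m , λ eq → pv≰y (at′ (cong proj₁ eq) q)))
        where
        at : ∀ {t} → t ≡ x → (∀ m → A (t , m)) → A u
        at refl a = a k
        at′ : ∀ {t} → t ≡ x → (∀ m → p (t , m) ≤ y) → p v ≤ y
        at′ refl q = q l

  same-comp⇒R≡ : ∀ u v → comp u ≡ comp v → R (p u) ≡ R (p v)
  same-comp⇒R≡ (x , k) (y , l) eq = go (Vertex-≡ N′ cN′ eq)
    where
    distinct : ∀ {k l} → Dec (k ≡ l) → R (p (x , k)) ≡ R (p (x , l))
    distinct (yes refl) = refl
    distinct (no k≢l) = bwd (R≡⇔∼ (p-V _) (p-V _)) (Swap⇒∼ (exchange⇒Swap (p-V _) (p-V _)
      (λ eq → k≢l (inj (p-injective eq))) (exchange-same x k≢l) (exchange-same x (k≢l ∘ sym))))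
      where
      inj : ∀ {k l} → _≡_ {A = G} (x , k) (x , l) → k ≡ l
      inj refl = refl
    go : ∀ {y l} → x ≡ y → R (p (x , k)) ≡ R (p (y , l))
    go refl = distinct (_ ≟ _)

  private
    -- In the union of the V_t with `t` below `z`, the set V_x is broken by removing one point, and
    -- V_y is built up to its last point, which is then added. The swap of `p u` and `p v` permits
    -- both moves.
    exchange′ : ∀ u v → comp u ≢ comp v → Swap (p u) (p v) → T′.Exchange (comp u) (comp v)
    exchange′ u v x≢y σ z x≤z y≰z =
      let y₁ , h₁ = toFace {λ t → comp t T′.≤ z} (λ t → comp t T′.≤? z) z
                      λ t → mk⇔ (λ q → q (k₀ t)) (λ q _ → q)
          y₂ , h₂ = remove (p-V u) (p-V v) σ {y₁} (bwd (h₁ u) x≤z) (y≰z ∘ fwd (h₁ v))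
          z₂ , h₂′ = fromFace y₂
          -- Drop the rest of V_x and insert V_y except `v`: no V_t is completed or lost, so this is
          -- again a face over `z₂`.
          y₃ , h₃ = toFace {A} A? z₂ λ t → A⇔ t ⇔∘ mk⇔
                      (λ (q , ne) m → fwd (h₂ _ (p-V _)) (bwd (h₁ (t , m)) q , ne ∘ cong comp ∘ p-injective))
                      (λ q → fwd (h₁ _) (proj₁ (bwd (h₂ _ (p-V _)) (q (k₀ t))))
                           , λ eq → proj₂ (bwd (h₂ _ (p-V _)) (at eq q)) refl)
                      ⇔∘ h₂′ t
          -- `p v` and its partner `p u` are both missing from `y₃`, so `add` can supply the last
          -- point of V_y.
          y₄ , h₄ = add (p-V v) (p-V u) (Swap-sym σ) (λ eq → x≢y (sym (cong comp (p-injective eq)))) {y₃}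
                      ([ y≰z ∘ proj₁ , (λ (_ , ne) → ne refl) ]′ ∘ fwd (h₃ v))
                      ([ (λ (_ , ne) → ne refl) , x≢y ∘ proj₁ ]′ ∘ fwd (h₃ u))
          z₄ , h₄′ = fromFace y₄
      in z₄ , λ t vt → mk⇔
           [ (λ q m → fwd (h₄ _ (p-V _)) (inj₁ (bwd (h₃ ((t , vt) , m)) (inj₁ q))))
           , (λ eq m → fwd (h₄ _ (p-V _)) (whole h₃ eq m (((t , vt) , m) ≟ᴳ v))) ]′
           (λ q → [ (λ r → [ inj₁ , inj₂ ∘ proj₁ ]′ (fwd (h₃ _) r)) , (λ eq → inj₂ (cong comp (p-injective eq))) ]′
                    (bwd (h₄ _ (p-V _)) (q (k₀ (t , vt)))))
           ⇔∘ h₄′ (t , vt)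
      where
      A : G → Set
      A t = (comp t T′.≤ z × comp t ≢ comp u) ⊎ (comp t ≡ comp v × t ≢ v)
      A? : Decidable A
      A? t = ((comp t T′.≤? z) ×-dec ¬? (comp t ≟ comp u)) ⊎-dec ((comp t ≟ comp v) ×-dec ¬? (t ≟ᴳ v))
      at : ∀ {t y} → proj₁ t ≡ comp u → (∀ m → p (t , m) ≤ y) → p u ≤ y
      at {t} eq q = go (Vertex-≡ N′ cN′ eq) q
        where
        go : ∀ {t y} → t ≡ proj₁ u → (∀ m → p (t , m) ≤ y) → p u ≤ y
        go refl q = q (proj₂ u)
      A⇔ : ∀ t → (∀ m → A (t , m)) ⇔ (proj₁ t T′.≤ z × proj₁ t ≢ comp u)
      A⇔ t = mk⇔ (λ a → [ id , (λ (eq , _) → ⊥-elim (v∉A (go (Vertex-≡ N′ cN′ eq) a))) ]′ (a (k₀ t))) (λ q _ → inj₁ q)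
        where
        v∉A : ¬ A v
        v∉A = [ y≰z ∘ proj₁ , (λ (_ , ne) → ne refl) ]′
        go : ∀ {t} → t ≡ proj₁ v → (∀ m → A (t , m)) → A v
        go refl a = a (proj₂ v)
      whole : ∀ {t y} → (∀ t → p t ≤ y ⇔ A t) → proj₁ t ≡ comp v → ∀ m → Dec ((t , m) ≡ v) →
              p (t , m) ≤ y ⊎ p (t , m) ≡ p v
      whole h eq m (yes e) = inj₂ (cong p e)
      whole h eq m (no ne) = inj₁ (bwd (h _) (inj₂ (eq , ne)))

  -- Otherwise `exchange′` yields a transposition automorphism of `N′`, against its primitivity.
  R≡⇒same-comp : ∀ u v → R (p u) ≡ R (p v) → comp u ≡ comp v
  R≡⇒same-comp u v eq = decidable-stable (comp u ≟ comp v) λ x≢y →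
    let σ = R-Swap (p-V u) (p-V v) (x≢y ∘ cong comp ∘ p-injective) eq
    in x≢y (N′-primitive _ _ (proj₂ (proj₁ u)) (proj₂ (proj₁ v)) (T′.Swap⇒∼
         (T′.exchange⇒Swap (proj₂ (proj₁ u)) (proj₂ (proj₁ v)) x≢y
           (exchange′ u v x≢y σ) (exchange′ v u (x≢y ∘ sym) (Swap-sym σ)))))

  private
    Corresponds : T′.El → TN.El → Set
    Corresponds z i = ∀ u → comp u T′.≤ z ⇔ R (p u) ≤ emb i

    abstract
      -- Passes through the union of the V_t with `t` below `z`, which contains the class of each of
      -- its points because no class leaves its V_t.
      forth : ∀ z → ∃[ i ] Corresponds z i
      forth z =
        let y , h = toFace {λ t → comp t T′.≤ z} (λ t → comp t T′.≤? z) z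
                      λ t → mk⇔ (λ q → q (k₀ t)) (λ q _ → q)
            i , hi = Face⇒N (_≤? y) (y , λ _ _ → ⇔-refl)
        in i , λ u → mk⇔
             (λ q w vw eq → let t , pt≡w = p-onto vw in
               subst (_≤ y) pt≡w (bwd (h t) (subst (T′._≤ z)
                 (sym (R≡⇒same-comp t u (trans (cong R pt≡w) eq))) q)))
             (λ full → fwd (h u) (full (p u) (p-V u) refl))
             ⇔∘ ⇔-sym (hi (p u) (p-V u))

      -- Passes through the union of the classes of `i`, which contains every V_t that it meets
      -- because V_t lies in one class.
      back : ∀ i → ∃[ z ] Corresponds z i
      back i =
        let y , h = saturated i
            z , hz = fromFace y
        in z , λ u → ⇔-sym (hz (proj₁ u)) ⇔∘ mk⇔
             (λ q → bwd (h _ (p-V u)) (q (proj₂ u)))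
             (λ q m → fwd (h _ (p-V _)) (subst (_≤ emb i) (same-comp⇒R≡ u (proj₁ u , m) refl) q))

    Corresponds-≤ : ∀ {z z′ i i′} → Corresponds z i → Corresponds z′ i′ → z T′.≤ z′ ⇔ emb i ≤ emb i′
    Corresponds-≤ {z} {z′} {i} {i′} h h′ = mk⇔
      (λ z≤z′ → ≤ᴺ {i} {i′} λ v vv q → let u , eq = p-onto vv in
        subst (λ v → R v ≤ emb i′) eq (fwd (h′ u) (T′.≤-trans (bwd (h u) (subst (λ v → R v ≤ emb i) (sym eq) q)) z≤z′)))
      (λ i≤i′ → T′.atomistic λ w vw w≤z → let u = (w , vw) , k₀ (w , vw) in
        bwd (h′ u) (≤-trans (fwd (h u) w≤z) i≤i′))

  isoN : Iso N′ N
  isoN = record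
    { to = proj₁ ∘ forth
    ; from = proj₁ ∘ back
    ; from-to = λ z → let i , h = forth z
                          z′ , h′ = back i
                      in T′.≤-antisym (bwd (Corresponds-≤ {i = i} {i′ = i} h′ h) ≤-refl)
                                      (bwd (Corresponds-≤ {i = i} {i′ = i} h h′) ≤-refl)
    ; to-from = λ i → let z , h = back i
                          i′ , h′ = forth z
                      in emb-injective (≤-antisym (fwd (Corresponds-≤ {i = i′} {i′ = i} h′ h) T′.≤-refl)
                                                  (fwd (Corresponds-≤ {i = i} {i′ = i′} h h′) T′.≤-refl))
    ; mono = λ z z′ → Corresponds-≤ {i = proj₁ (forth z)} {i′ = proj₁ (forth z′)} (proj₂ (forth z)) (proj₂ (forth z′)) }

  -- `p` matches V_x with the class at the image of `x`: a vertex of that class comes from a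
  -- component below `x`, which is `x` itself by minimality of vertices.
  isoN-size : ∀ x vx → f′ (x , vx) ≡ ∣ ⋃ (classes (to isoN x)) ∣
  isoN-size x vx = cantor-schröder-bernstein {f = into} {g = out}
    (λ {k} {l} eq → inj (p-injective (trans (sym (enum-into k)) (trans (cong (enum C) eq) (enum-into l)))))
    (λ {k} {l} eq → enum-injective C (trans (sym (p-out k)) (trans (cong (λ k → p ((x , vx) , k)) eq) (p-out l))))
    where
    i = to isoN x
    C = ⋃ (classes i)
    h : Corresponds x i
    h = proj₂ (forth x)
    inj : ∀ {k l} → _≡_ {A = G} ((x , vx) , k) ((x , vx) , l) → k ≡ l
    inj refl = refl
    p∈ : ∀ k → p ((x , vx) , k) Sub.∈ C
    p∈ k = bwd (∈-⋃classes {i}) (p-V _ , fwd (h _) T′.≤-refl)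
    into : Fin (f′ (x , vx)) → Fin ∣ C ∣
    into k = index C (p∈ k)
    enum-into : ∀ k → enum C (into k) ≡ p ((x , vx) , k)
    enum-into k = enum-index C (p∈ k)
    coordinate : ∀ {w} → w Sub.∈ C → ∃[ k ] p ((x , vx) , k) ≡ w
    coordinate {w} w∈ =
      let vw , q = fwd (∈-⋃classes {i}) w∈
          u , eq = p-onto vw
      in go u eq (Vertex-≡ N′ cN′ (T′.V-minimal (proj₂ (proj₁ u)) vx (bwd (h u) (subst (λ w → R w ≤ emb i) (sym eq) q))))
      where
      go : ∀ u → p u ≡ w → proj₁ u ≡ (x , vx) → ∃[ k ] p ((x , vx) , k) ≡ w
      go (_ , k) eq refl = k , eq
    out : Fin ∣ C ∣ → Fin (f′ (x , vx))
    out j = proj₁ (coordinate (enum-∈ C j))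
    p-out : ∀ j → p ((x , vx) , out j) ≡ enum C j
    p-out j = proj₂ (coordinate (enum-∈ C j))

theorem6p2 : (M : FinPoset) (cM : IsCPM M) → IsProper M cM →
    Σ FinPoset λ N → Σ (IsCPM N) λ cN → Σ (QuotIso M cM N) λ ψ →
    IsPrimitive N cN
    × (∀ x → 1 ℕ.≤ quotSize M cM cN ψ x)
    × IsoAngle N cN (quotSize M cM cN ψ) M
    × ((N' : FinPoset) (cN' : IsCPM N') (f' : Vertex N' cN' → ℕ) →
    IsPrimitive N' cN' → (∀ x → 1 ℕ.≤ f' x) → IsoAngle N' cN' f' M →
    Σ (Iso N' N) λ φ → ∀ x p q →
    f' (x , p) ≡ quotSize M cM cN ψ (to φ x , q))
theorem6p2 M cM proper = N , cN , quotIso , N-primitive , 1≤f , isoAngle , unique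
  where
  s = proj₁ (ProperCPM.nonReps M cM proper)
  s-shadow : ∀ {w} → IsVertex M cM w → ProperCPM.R M cM proper w ≢ w ⇔ _≤ₚ_ M w s
  s-shadow {w} = proj₂ (ProperCPM.nonReps M cM proper) w

  open Quotient M cM proper s s-shadow

  unique : ∀ N′ cN′ f′ → IsPrimitive N′ cN′ → (∀ x → 1 ℕ.≤ f′ x) → IsoAngle N′ cN′ f′ M →
    Σ (Iso N′ N) λ φ → ∀ x p q → f′ (x , p) ≡ f (to φ x , q)
  unique N′ cN′ f′ N′-primitive 1≤f′ iso = isoN , λ x vx _ → isoN-size x vx
    where
    open Uniqueness M cM proper s s-shadow N′ cN′ f′ N′-primitive 1≤f′
      (coordinates M cM N′ cN′ f′ 1≤f′ iso)
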